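{- There exist an absolute constant $C > 0$ and an integer $n_0$ such that for all $n \ge n_0$ the following holds. If $r < n/2 - C\sqrt{n}$ and $A, B \subseteq \mathbb{F}_2^n$ are sets with $\mathbb{F}_2^n = B_r(0) \cup A \cup B$, then at least one of $A + A$ and $B + B$ contains a coset of codimension $1$.
   Context: For a real number $r$, $B_r(0) \subseteq \mathbb{F}_2^n$ is the Hamming ball of radius $r$ around $0$, i.e. the set of vectors in $\mathbb{F}_2^n$ with at most $r$ coordinates equal to $1$. For $A \subseteq \mathbb{F}_2^n$, $A + A = \{a + a' : a, a' \in A\}$. A coset of codimension $1$ is a set of the form $v + V$ where $v \in \mathbb{F}_2^n$ and $V \le \mathbb{F}_2^n$ is a linear subspace of dimension $n-1$. -}

module Defs where

open import Data.Bool.Base using (Bool; true; false; _∧_; _xor_)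
open import Data.Bool.Properties using () renaming (_≟_ to _≟ᵇ_)
open import Data.Integer.Base as ℤ using (+_; +[1+_]; -[1+_])
import Data.Integer.Properties as ℤ
open import Data.Nat.Base as ℕ using (ℕ; zero; suc)
import Data.Nat.Properties as ℕ
open import Data.Nat.Tactic.RingSolver using (solve-∀)
open import Data.Product.Base using (Σ; ∃; ∃₂; _×_; _,_)
open import Data.Rational.Base as ℚ using (ℚ; mkℚ; 0ℚ; 1ℚ; ½; toℚᵘ)
import Data.Rational.Properties as ℚ
open import Data.Rational.Solver using (module +-*-Solver)
open import Data.Rational.Unnormalised.Base as ℚᵘ using (mkℚᵘ)
import Data.Rational.Unnormalised.Properties as ℚᵘ
open import Data.Sum.Base using (inj₁; inj₂)
open import Data.Vec.Base using (Vec; count; foldr′; map; replicate; zipWith)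
open import Data.Vec.Relation.Unary.All using (All)
open import Level using (0ℓ)
open import Relation.Binary.PropositionalEquality
open import Relation.Nullary using (¬_; yes; no)
open import Relation.Unary using (Pred; _∈_; _⊆_; _≐_)

------------------------------------------------------------------------
-- Real numbers: Cauchy sequences of rationals with pointwise operations.
-- Two sequences denote the same real when neither is _<ℝ_ the other.

record ℝ : Set where
  constructor mkℝ
  field
    seq    : ℕ → ℚ
    cauchy : ∀ ε → 0ℚ ℚ.< ε → ∃ λ N → ∀ i j → N ℕ.≤ i → N ℕ.≤ j →
             ℚ.∣ seq i ℚ.- seq j ∣ ℚ.≤ ε

open ℝ

infix 4 _<ℝ_ _≤ℝ_

_<ℝ_ : ℝ → ℝ → Set
x <ℝ y = ∃₂ λ ε N → 0ℚ ℚ.< ε × (∀ k → N ℕ.≤ k → seq x k ℚ.+ ε ℚ.≤ seq y k)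

_≤ℝ_ : ℝ → ℝ → Set
x ≤ℝ y = ¬ (y <ℝ x)

fromℚ : ℚ → ℝ
fromℚ q = mkℝ (λ _ → q) λ ε 0<ε → 0 , λ _ _ _ _ →
  subst (λ z → ℚ.∣ z ∣ ℚ.≤ ε) (sym (ℚ.+-inverseʳ q)) (ℚ.<⇒≤ 0<ε)

fromℕ : ℕ → ℝ
fromℕ n = fromℚ (+ n ℚ./ 1)

0ℝ : ℝ
0ℝ = fromℚ 0ℚ

private
  ½+½ : ∀ ε → ε ℚ.* ½ ℚ.+ ε ℚ.* ½ ≡ ε
  ½+½ ε = trans (sym (ℚ.*-distribˡ-+ ε ½ ½)) (ℚ.*-identityʳ ε)

  half-pos : ∀ {ε} → 0ℚ ℚ.< ε → 0ℚ ℚ.< ε ℚ.* ½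
  half-pos {ε} 0<ε = ℚ.positive⁻¹ (ε ℚ.* ½)
    {{ℚ.pos*pos⇒pos ε {{ℚ.positive 0<ε}} ½}}

  sub-interchange : ∀ a b c d →
    (a ℚ.- b) ℚ.- (c ℚ.- d) ≡ (a ℚ.- c) ℚ.- (b ℚ.- d)
  sub-interchange = solve 4 (λ a b c d →
    (a :- b) :- (c :- d) := (a :- c) :- (b :- d)) refl
    where open +-*-Solver

infixl 6 _-ℝ_

_-ℝ_ : ℝ → ℝ → ℝ
x -ℝ y = mkℝ (λ k → seq x k ℚ.- seq y k) λ ε 0<ε →
  let (N₁ , c₁) = cauchy x (ε ℚ.* ½) (half-pos 0<ε)
      (N₂ , c₂) = cauchy y (ε ℚ.* ½) (half-pos 0<ε)
  in N₁ ℕ.⊔ N₂ , λ i j N≤i N≤j → begin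
    ℚ.∣ (seq x i ℚ.- seq y i) ℚ.- (seq x j ℚ.- seq y j) ∣
      ≡⟨ cong ℚ.∣_∣ (sub-interchange (seq x i) (seq y i) (seq x j) (seq y j)) ⟩
    ℚ.∣ (seq x i ℚ.- seq x j) ℚ.- (seq y i ℚ.- seq y j) ∣
      ≤⟨ ℚ.∣p-q∣≤∣p∣+∣q∣ (seq x i ℚ.- seq x j) (seq y i ℚ.- seq y j) ⟩
    ℚ.∣ seq x i ℚ.- seq x j ∣ ℚ.+ ℚ.∣ seq y i ℚ.- seq y j ∣
      ≤⟨ ℚ.+-mono-≤ (c₁ i j (ℕ.m⊔n≤o⇒m≤o N₁ N₂ N≤i) (ℕ.m⊔n≤o⇒m≤o N₁ N₂ N≤j))
                    (c₂ i j (ℕ.m⊔n≤o⇒n≤o N₁ N₂ N≤i) (ℕ.m⊔n≤o⇒n≤o N₁ N₂ N≤j)) ⟩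
    ε ℚ.* ½ ℚ.+ ε ℚ.* ½
      ≡⟨ ½+½ ε ⟩
    ε ∎
  where open ℚ.≤-Reasoning

private
  0<1 : 0ℚ ℚ.< 1ℚ
  0<1 = ℚ.positive⁻¹ 1ℚ

  bounded : ∀ x → ∃₂ λ b N → ℚ.Positive b × (∀ k → N ℕ.≤ k → ℚ.∣ seq x k ∣ ℚ.≤ b)
  bounded x with cauchy x 1ℚ 0<1
  ... | N , c = 1ℚ ℚ.+ ℚ.∣ seq x N ∣ , N ,
      ℚ.pos+nonNeg⇒pos 1ℚ ℚ.∣ seq x N ∣ {{ℚ.∣-∣-nonNeg (seq x N)}} ,
      λ k N≤k → begin
        ℚ.∣ seq x k ∣
          ≡⟨ cong ℚ.∣_∣ (split (seq x k) (seq x N)) ⟩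
        ℚ.∣ (seq x k ℚ.- seq x N) ℚ.+ seq x N ∣
          ≤⟨ ℚ.∣p+q∣≤∣p∣+∣q∣ (seq x k ℚ.- seq x N) (seq x N) ⟩
        ℚ.∣ seq x k ℚ.- seq x N ∣ ℚ.+ ℚ.∣ seq x N ∣
          ≤⟨ ℚ.+-monoˡ-≤ ℚ.∣ seq x N ∣ (c k N N≤k ℕ.≤-refl) ⟩
        1ℚ ℚ.+ ℚ.∣ seq x N ∣ ∎
    where
    open ℚ.≤-Reasoning
    split : ∀ a b → a ≡ (a ℚ.- b) ℚ.+ b
    split = solve 2 (λ a b → a := (a :- b) :+ b) refl
      where open +-*-Solver

  *-mono-abs : ∀ p q {b c} → ℚ.Positive b →
    ℚ.∣ p ∣ ℚ.≤ b → ℚ.∣ q ∣ ℚ.≤ c → ℚ.∣ p ℚ.* q ∣ ℚ.≤ b ℚ.* c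
  *-mono-abs p q {b} {c} b>0 p≤b q≤c = begin
    ℚ.∣ p ℚ.* q ∣         ≡⟨ ℚ.∣p*q∣≡∣p∣*∣q∣ p q ⟩
    ℚ.∣ p ∣ ℚ.* ℚ.∣ q ∣   ≤⟨ ℚ.*-monoʳ-≤-nonNeg ℚ.∣ q ∣ {{ℚ.∣-∣-nonNeg q}} p≤b ⟩
    b ℚ.* ℚ.∣ q ∣         ≤⟨ ℚ.*-monoˡ-≤-nonNeg b {{ℚ.pos⇒nonNeg b {{b>0}}}} q≤c ⟩
    b ℚ.* c               ∎
    where open ℚ.≤-Reasoning

  mul-split : ∀ a b c d →
    a ℚ.* b ℚ.- c ℚ.* d ≡ a ℚ.* (b ℚ.- d) ℚ.+ d ℚ.* (a ℚ.- c)
  mul-split = solve 4 (λ a b c d →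
    a :* b :- c :* d := a :* (b :- d) :+ d :* (a :- c)) refl
    where open +-*-Solver

  shrink : ∀ m ε → ℚ.Positive m → 0ℚ ℚ.< ε → ∃ λ δ → 0ℚ ℚ.< δ × m ℚ.* δ ≡ ε
  shrink m ε m>0 0<ε = m⁻¹ ℚ.* ε ,
      ℚ.positive⁻¹ (m⁻¹ ℚ.* ε) {{ℚ.pos*pos⇒pos m⁻¹ {{ℚ.1/pos⇒pos m {{m>0}}}} ε {{ℚ.positive 0<ε}}}} ,
      trans (sym (ℚ.*-assoc m m⁻¹ ε))
        (trans (cong (ℚ._* ε) (ℚ.*-inverseʳ m {{m≢0}})) (ℚ.*-identityˡ ε))
    where
    m≢0 : ℚ.NonZero m
    m≢0 = ℚ.pos⇒nonZero m {{m>0}}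
    m⁻¹ : ℚ
    m⁻¹ = ℚ.1/_ m {{m≢0}}

  *-close : ∀ p q p′ q′ {b c δ ε} → ℚ.Positive b → ℚ.Positive c →
    ℚ.∣ p ∣ ℚ.≤ b → ℚ.∣ q′ ∣ ℚ.≤ c →
    ℚ.∣ p ℚ.- p′ ∣ ℚ.≤ δ → ℚ.∣ q ℚ.- q′ ∣ ℚ.≤ δ →
    (b ℚ.+ c) ℚ.* δ ≡ ε → ℚ.∣ p ℚ.* q ℚ.- p′ ℚ.* q′ ∣ ℚ.≤ ε
  *-close p q p′ q′ {b} {c} {δ} {ε} b>0 c>0 p≤b q′≤c Δp Δq eq = begin
    ℚ.∣ p ℚ.* q ℚ.- p′ ℚ.* q′ ∣
      ≡⟨ cong ℚ.∣_∣ (mul-split p q p′ q′) ⟩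
    ℚ.∣ p ℚ.* (q ℚ.- q′) ℚ.+ q′ ℚ.* (p ℚ.- p′) ∣
      ≤⟨ ℚ.∣p+q∣≤∣p∣+∣q∣ (p ℚ.* (q ℚ.- q′)) (q′ ℚ.* (p ℚ.- p′)) ⟩
    ℚ.∣ p ℚ.* (q ℚ.- q′) ∣ ℚ.+ ℚ.∣ q′ ℚ.* (p ℚ.- p′) ∣
      ≤⟨ ℚ.+-mono-≤ (*-mono-abs p (q ℚ.- q′) b>0 p≤b Δq)
                    (*-mono-abs q′ (p ℚ.- p′) c>0 q′≤c Δp) ⟩
    b ℚ.* δ ℚ.+ c ℚ.* δ
      ≡⟨ sym (ℚ.*-distribʳ-+ δ b c) ⟩
    (b ℚ.+ c) ℚ.* δ
      ≡⟨ eq ⟩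
    ε ∎
    where open ℚ.≤-Reasoning

  *-cauchy : ∀ x y ε → 0ℚ ℚ.< ε → ∃ λ N → ∀ i j → N ℕ.≤ i → N ℕ.≤ j →
    ℚ.∣ seq x i ℚ.* seq y i ℚ.- seq x j ℚ.* seq y j ∣ ℚ.≤ ε
  *-cauchy x y ε 0<ε =
    let (b , M₁ , b>0 , bx) = bounded x
        (c , M₂ , c>0 , cy) = bounded y
        (δ , 0<δ , eq) = shrink (b ℚ.+ c) ε (ℚ.pos+pos⇒pos b {{b>0}} c {{c>0}}) 0<ε
        (N₁ , Δx) = cauchy x δ 0<δ
        (N₂ , Δy) = cauchy y δ 0<δ
        M = M₁ ℕ.⊔ M₂
        N = N₁ ℕ.⊔ N₂
        ≥M : ∀ {k} → M ℕ.⊔ N ℕ.≤ k → M ℕ.≤ k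
        ≥M = ℕ.m⊔n≤o⇒m≤o M N
        ≥N : ∀ {k} → M ℕ.⊔ N ℕ.≤ k → N ℕ.≤ k
        ≥N = ℕ.m⊔n≤o⇒n≤o M N
    in M ℕ.⊔ N , λ i j l l′ → *-close (seq x i) (seq y i) (seq x j) (seq y j) b>0 c>0
         (bx i (ℕ.m⊔n≤o⇒m≤o M₁ M₂ (≥M l)))
         (cy j (ℕ.m⊔n≤o⇒n≤o M₁ M₂ (≥M l′)))
         (Δx i j (ℕ.m⊔n≤o⇒m≤o N₁ N₂ (≥N l)) (ℕ.m⊔n≤o⇒m≤o N₁ N₂ (≥N l′)))
         (Δy i j (ℕ.m⊔n≤o⇒n≤o N₁ N₂ (≥N l)) (ℕ.m⊔n≤o⇒n≤o N₁ N₂ (≥N l′)))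
         eq

infixl 7 _*ℝ_

_*ℝ_ : ℝ → ℝ → ℝ
x *ℝ y = mkℝ (λ k → seq x k ℚ.* seq y k) (*-cauchy x y)

⌊√_⌋ : ℕ → ℕ
⌊√ zero ⌋ = 0
⌊√ suc m ⌋ with suc ⌊√ m ⌋ ℕ.* suc ⌊√ m ⌋ ℕ.≤? suc m
... | yes _ = suc ⌊√ m ⌋
... | no  _ = ⌊√ m ⌋

⌊√⌋-lower : ∀ m → ⌊√ m ⌋ ℕ.* ⌊√ m ⌋ ℕ.≤ m
⌊√⌋-lower zero = ℕ.z≤n
⌊√⌋-lower (suc m) with suc ⌊√ m ⌋ ℕ.* suc ⌊√ m ⌋ ℕ.≤? suc m
... | yes p = p
... | no  _ = ℕ.m≤n⇒m≤1+n (⌊√⌋-lower m)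

⌊√⌋-upper : ∀ m → m ℕ.< suc ⌊√ m ⌋ ℕ.* suc ⌊√ m ⌋
⌊√⌋-upper zero = ℕ.s≤s ℕ.z≤n
⌊√⌋-upper (suc m) with suc ⌊√ m ⌋ ℕ.* suc ⌊√ m ⌋ ℕ.≤? suc m
... | yes _ = ℕ.≤-<-trans (⌊√⌋-upper m)
                (ℕ.*-mono-< (ℕ.n<1+n (suc ⌊√ m ⌋)) (ℕ.n<1+n (suc ⌊√ m ⌋)))
... | no ¬p = ℕ.≰⇒> ¬p

private
  √-scale : ℕ → ℕ → ℕ
  √-scale n k = ⌊√ n ℕ.* (suc k ℕ.* suc k) ⌋

  √-cross : ∀ n i j → √-scale n i ℕ.* suc j ℕ.≤ suc (√-scale n j) ℕ.* suc i
  √-cross n i j = ℕ.≮⇒≥ λ lt → ℕ.<-irrefl refl (begin-strict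
    s ℕ.* q ℕ.* (s ℕ.* q)                   ≡⟨ interchange s q ⟩
    s ℕ.* s ℕ.* (q ℕ.* q)                   ≤⟨ ℕ.*-monoˡ-≤ (q ℕ.* q) (⌊√⌋-lower (n ℕ.* (p ℕ.* p))) ⟩
    n ℕ.* (p ℕ.* p) ℕ.* (q ℕ.* q)           ≡⟨ swap n (p ℕ.* p) (q ℕ.* q) ⟩
    n ℕ.* (q ℕ.* q) ℕ.* (p ℕ.* p)           ≤⟨ ℕ.*-monoˡ-≤ (p ℕ.* p) (ℕ.<⇒≤ (⌊√⌋-upper (n ℕ.* (q ℕ.* q)))) ⟩
    suc t ℕ.* suc t ℕ.* (p ℕ.* p)           ≡⟨ sym (interchange (suc t) p) ⟩
    suc t ℕ.* p ℕ.* (suc t ℕ.* p)           <⟨ ℕ.*-mono-< lt lt ⟩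
    s ℕ.* q ℕ.* (s ℕ.* q)                   ∎)
    where
    open ℕ.≤-Reasoning
    p = suc i
    q = suc j
    s = √-scale n i
    t = √-scale n j
    interchange : ∀ a b → a ℕ.* b ℕ.* (a ℕ.* b) ≡ a ℕ.* a ℕ.* (b ℕ.* b)
    interchange = solve-∀
    swap : ∀ a b c → a ℕ.* b ℕ.* c ≡ a ℕ.* c ℕ.* b
    swap = solve-∀

  √-seq : ℕ → ℕ → ℚ
  √-seq n k = + √-scale n k ℚ./ suc k

  √-step : ∀ n i j → √-seq n i ℚ.≤ √-seq n j ℚ.+ + 1 ℚ./ suc j
  √-step n i j = ℚ.toℚᵘ-cancel-≤ (begin
    toℚᵘ (√-seq n i)                              ≃⟨ ℚ.toℚᵘ-fromℚᵘ (mkℚᵘ (+ s) i) ⟩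
    mkℚᵘ (+ s) i                                  ≤⟨ ℚᵘ.*≤* cross ⟩
    mkℚᵘ (+ t) j ℚᵘ.+ mkℚᵘ (+ 1) j                ≃⟨ ℚᵘ.+-cong (ℚᵘ.≃-sym (ℚ.toℚᵘ-fromℚᵘ (mkℚᵘ (+ t) j)))
                                                               (ℚᵘ.≃-sym (ℚ.toℚᵘ-fromℚᵘ (mkℚᵘ (+ 1) j))) ⟩
    toℚᵘ (√-seq n j) ℚᵘ.+ toℚᵘ (+ 1 ℚ./ suc j)    ≃⟨ ℚᵘ.≃-sym (ℚ.toℚᵘ-homo-+ (√-seq n j) (+ 1 ℚ./ suc j)) ⟩
    toℚᵘ (√-seq n j ℚ.+ + 1 ℚ./ suc j)            ∎)
    where
    open ℚᵘ.≤-Reasoning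
    s = √-scale n i
    t = √-scale n j
    nat : s ℕ.* (suc j ℕ.* suc j) ℕ.≤ (t ℕ.* suc j ℕ.+ 1 ℕ.* suc j) ℕ.* suc i
    nat = subst₂ ℕ._≤_ (ℕ.*-assoc s (suc j) (suc j)) (eq t (suc i) (suc j))
            (ℕ.*-monoˡ-≤ (suc j) (√-cross n i j))
      where
      eq : ∀ t p q → suc t ℕ.* p ℕ.* q ≡ (t ℕ.* q ℕ.+ 1 ℕ.* q) ℕ.* p
      eq = solve-∀
    cross : + s ℤ.* + (suc j ℕ.* suc j) ℤ.≤
            (+ t ℤ.* + suc j ℤ.+ + 1 ℤ.* + suc j) ℤ.* + suc i
    cross = subst₂ ℤ._≤_ (ℤ.pos-* s (suc j ℕ.* suc j))
      (trans (ℤ.pos-* (t ℕ.* suc j ℕ.+ 1 ℕ.* suc j) (suc i))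
        (cong (ℤ._* + suc i) (trans (ℤ.pos-+ (t ℕ.* suc j) (1 ℕ.* suc j))
          (cong₂ ℤ._+_ (ℤ.pos-* t (suc j)) (ℤ.pos-* 1 (suc j))))))
      (ℤ.+≤+ nat)

  archimedes : ∀ ε → 0ℚ ℚ.< ε → ∀ k → ℚ.denominator-1 ε ℕ.≤ k → + 1 ℚ./ suc k ℚ.≤ ε
  archimedes (mkℚ (+ 0) d _) (ℚ.*<* (ℤ.+<+ ())) k d≤k
  archimedes (mkℚ -[1+ _ ] d _) (ℚ.*<* ()) k d≤k
  archimedes ε@(mkℚ +[1+ a ] d _) _ k d≤k = ℚ.toℚᵘ-cancel-≤ (begin
    toℚᵘ (+ 1 ℚ./ suc k)   ≃⟨ ℚ.toℚᵘ-fromℚᵘ (mkℚᵘ (+ 1) k) ⟩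
    mkℚᵘ (+ 1) k           ≤⟨ ℚᵘ.*≤* (subst₂ ℤ._≤_ (ℤ.pos-* 1 (suc d)) (ℤ.pos-* (suc a) (suc k))
                                (ℤ.+≤+ (ℕ.*-mono-≤ (ℕ.s≤s (ℕ.z≤n {a})) (ℕ.s≤s d≤k)))) ⟩
    toℚᵘ ε                 ∎)
    where open ℚᵘ.≤-Reasoning

  abs-≤ : ∀ p q {ε} → p ℚ.≤ q ℚ.+ ε → q ℚ.≤ p ℚ.+ ε → ℚ.∣ p ℚ.- q ∣ ℚ.≤ ε
  abs-≤ p q {ε} p≤ q≤ with ℚ.∣p∣≡p∨∣p∣≡-p (p ℚ.- q)
  ... | inj₁ e = subst₂ ℚ._≤_ (sym e) (cancel q ε) (ℚ.+-monoˡ-≤ (ℚ.- q) p≤)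
    where
    open +-*-Solver
    cancel : ∀ q ε → (q ℚ.+ ε) ℚ.- q ≡ ε
    cancel = solve 2 (λ q ε → (q :+ ε) :- q := ε) refl
  ... | inj₂ e = subst₂ ℚ._≤_ (trans (flip q p) (sym e)) (cancel p ε) (ℚ.+-monoˡ-≤ (ℚ.- p) q≤)
    where
    open +-*-Solver
    cancel : ∀ q ε → (q ℚ.+ ε) ℚ.- q ≡ ε
    cancel = solve 2 (λ q ε → (q :+ ε) :- q := ε) refl
    flip : ∀ q p → q ℚ.- p ≡ ℚ.- (p ℚ.- q)
    flip = solve 2 (λ q p → q :- p := :- (p :- q)) refl

-- √ n is the limit of ⌊√(n (k+1)²)⌋ / (k+1), whose k-th term lies within
-- 1/(k+1) below the square root of n.
√_ : ℕ → ℝ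
√ n = mkℝ (λ k → + ⌊√ n ℕ.* (suc k ℕ.* suc k) ⌋ ℚ./ suc k) λ ε 0<ε →
  ℚ.denominator-1 ε , λ i j N≤i N≤j → abs-≤ (√-seq n i) (√-seq n j)
    (ℚ.≤-trans (√-step n i j) (ℚ.+-monoʳ-≤ (√-seq n j) (archimedes ε 0<ε j N≤j)))
    (ℚ.≤-trans (√-step n j i) (ℚ.+-monoʳ-≤ (√-seq n i) (archimedes ε 0<ε i N≤i)))

------------------------------------------------------------------------
-- The vector space 𝔽₂ⁿ, with 𝔽₂ the field (Bool, _xor_, _∧_).

𝔽₂ : Set
𝔽₂ = Bool

𝔽₂^ : ℕ → Set
𝔽₂^ n = Vec 𝔽₂ n

infixl 6 _⊕_
infixl 7 _·_

_⊕_ : ∀ {n} → 𝔽₂^ n → 𝔽₂^ n → 𝔽₂^ n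
_⊕_ = zipWith _xor_

_·_ : ∀ {n} → 𝔽₂ → 𝔽₂^ n → 𝔽₂^ n
c · v = map (c ∧_) v

𝟎 : ∀ {n} → 𝔽₂^ n
𝟎 {n} = replicate n false

weight : ∀ {n} → 𝔽₂^ n → ℕ
weight = count (_≟ᵇ true)

HammingBall : ∀ {n} → ℝ → Pred (𝔽₂^ n) 0ℓ
HammingBall r x = fromℕ (weight x) ≤ℝ r

infixl 6 _⊞_

_⊞_ : ∀ {n} → Pred (𝔽₂^ n) 0ℓ → Pred (𝔽₂^ n) 0ℓ → Pred (𝔽₂^ n) 0ℓ
(A ⊞ B) x = ∃₂ λ a b → a ∈ A × b ∈ B × x ≡ a ⊕ b

linearCombination : ∀ {n d} → Vec 𝔽₂ d → Vec (𝔽₂^ n) d → 𝔽₂^ n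
linearCombination c b = foldr′ _⊕_ 𝟎 (zipWith _·_ c b)

LinearlyIndependent : ∀ {n d} → Vec (𝔽₂^ n) d → Set
LinearlyIndependent {d = d} b = ∀ c → linearCombination c b ≡ 𝟎 → c ≡ replicate d false

record IsSubspace {n} (V : Pred (𝔽₂^ n) 0ℓ) : Set where
  field
    𝟎-closed : 𝟎 ∈ V
    ⊕-closed : ∀ {x y} → x ∈ V → y ∈ V → x ⊕ y ∈ V
    ·-closed : ∀ c {x} → x ∈ V → c · x ∈ V

record IsBasis {n d} (V : Pred (𝔽₂^ n) 0ℓ) (b : Vec (𝔽₂^ n) d) : Set where
  field
    members     : All V b
    independent : LinearlyIndependent b
    spanning    : ∀ {x} → x ∈ V → ∃ λ c → linearCombination c b ≡ x

HasDimension : ∀ {n} → Pred (𝔽₂^ n) 0ℓ → ℕ → Set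
HasDimension {n} V d = Σ (Vec (𝔽₂^ n) d) (IsBasis V)

translate : ∀ {n} → 𝔽₂^ n → Pred (𝔽₂^ n) 0ℓ → Pred (𝔽₂^ n) 0ℓ
translate v V x = ∃ λ w → w ∈ V × x ≡ v ⊕ w

-- The dimension n − k is written as the d with d + k ≡ n, so that there is
-- no truncated subtraction.
record IsCosetOfCodimension {n} (k : ℕ) (S : Pred (𝔽₂^ n) 0ℓ) : Set₁ where
  field
    v          : 𝔽₂^ n
    V          : Pred (𝔽₂^ n) 0ℓ
    isSubspace : IsSubspace V
    d          : ℕ
    d+k≡n      : d ℕ.+ k ≡ n
    dimension  : HasDimension V d
    isCoset    : S ≐ translate v V

ContainsCosetOfCodimension : ∀ {n} → ℕ → Pred (𝔽₂^ n) 0ℓ → Set₁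
ContainsCosetOfCodimension k P = ∃ λ S → IsCosetOfCodimension k S × S ⊆ P

{-# OPTIONS --safe #-}

-- Let X be the set of vectors outside A + A and Y the set of vectors outside B + B.
-- By linear algebra over 𝔽₂, either some u has dot u x = 1 for all x in X, and then
-- A + A contains the hyperplane orthogonal to u, or X satisfies a relation
-- x₁ + ... + xₘ = 0 with m odd and m ≤ n + 1; likewise for Y.  Given two such
-- relations, fix y in Y.  A walk z, z + x₁, z + x₁ + y, z + x₁ + y + x₂, ...
-- starting in A alternates between A and B as long as it avoids the Hamming ball,
-- and as m is odd it contradicts the choice of xₘ when it returns to z; if z lies in
-- B, the roles of A and B are exchanged.  So it suffices to find z for which the at most
-- 4n + 2 points of both walks have weight at least n/2 - O(√n).  This is Spencer's
-- "six standard deviations" theorem, here with a crude constant: by the fourth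
-- moment most sign vectors have few large correlations with the given vectors, so
-- by pigeonhole two distant sign vectors have nearly equal correlations; half
-- their difference colours a positive fraction of the coordinates, and one iterates.

module Submission where

open import Defs
open import Data.Bool.Base using (Bool; true; false; not; _xor_; _∧_; if_then_else_; T)
open import Data.Bool.Properties
  using (xor-assoc; xor-comm; xor-same; xor-identityˡ; xor-identityʳ; ∧-comm; ∧-zeroʳ;
         ∧-identityʳ; ∧-distribˡ-xor; not-involutive; not-distribˡ-xor; ¬-not; T?)
  renaming (_≟_ to _≟ᵇ_)
open import Data.Empty using (⊥; ⊥-elim)
open import Data.Integer.Base as ℤ using (ℤ; -[1+_]; 0ℤ; ∣_∣)
import Data.Integer.Properties as ℤ
open import Data.Integer.Tactic.RingSolver using () renaming (solve-∀ to ℤ-solve-∀)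
open import Data.List.Base using (List; []; _∷_; _++_; length; map; foldr)
open import Data.List.Membership.Propositional using () renaming (_∈_ to _∈ˡ_)
open import Data.List.Membership.Propositional.Properties using (∈-map⁺; ∈-++⁺ˡ; ∈-++⁺ʳ)
import Data.List.Properties as List
open import Data.List.Properties using (length-map; length-++)
open import Data.List.Relation.Unary.All using (All; []; _∷_)
open import Data.List.Relation.Unary.Any using (here; there)
open import Data.Nat.Base hiding (_/_)
open import Data.Nat.DivMod using (m≡m%n+[m/n]*n; m%n<n; m/n*n≤m)
  renaming (_/_ to _div_; _%_ to _mod_)
open import Data.Nat.ListAction using (sum)
open import Data.Nat.Properties
open import Data.Nat.Tactic.RingSolver using (solve-∀)
open import Data.Product.Base using (Σ; ∃; ∃₂; _×_; _,_; proj₂)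
open import Data.Rational.Base as ℚ using (1ℚ; toℚᵘ)
import Data.Rational.Properties as ℚ
open import Data.Rational.Solver using (module +-*-Solver)
open import Data.Rational.Unnormalised.Base as ℚᵘ using (mkℚᵘ)
import Data.Rational.Unnormalised.Properties as ℚᵘ
open import Data.Sum.Base as Sum using (_⊎_; inj₁; inj₂)
open import Data.Unit.Base using (tt)
open import Data.Vec.Base as Vec using (Vec; []; _∷_; head; tail; replicate)
open import Data.Vec.Properties
  using (zipWith-assoc; zipWith-comm; zipWith-identityˡ; zipWith-identityʳ; ∷-injective; ≡-dec)
import Data.Vec.Relation.Unary.All as VecAll using (All; []; _∷_; map)
import Data.Vec.Relation.Unary.All.Properties as VecAll using (map⁺)
open import Function.Base using (_∘_; id)
open import Level using (0ℓ)
open import Relation.Binary.PropositionalEquality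
open import Relation.Nullary using (¬_; Dec; yes; no; contradiction; _×-dec_; ¬?)
open import Relation.Nullary.Decidable using (decidable-stable)
open import Relation.Unary using (Pred; Decidable; _∈_; _⊆_; _∪_; _≐_)

-- Sums over the cube

∑ : ∀ {s} → (Vec Bool s → ℕ) → ℕ
∑ {zero}  f = f []
∑ {suc s} f = ∑ (λ z → f (true ∷ z)) + ∑ (λ z → f (false ∷ z))

∑-mono-≤ : ∀ {s} {f g : Vec Bool s → ℕ} → (∀ z → f z ≤ g z) → ∑ f ≤ ∑ g
∑-mono-≤ {zero}  f≤g = f≤g []
∑-mono-≤ {suc s} f≤g = +-mono-≤ (∑-mono-≤ (λ z → f≤g (true ∷ z))) (∑-mono-≤ (λ z → f≤g (false ∷ z)))

∑-cong : ∀ {s} {f g : Vec Bool s → ℕ} → (∀ z → f z ≡ g z) → ∑ f ≡ ∑ g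
∑-cong {zero}  f≡g = f≡g []
∑-cong {suc s} f≡g = cong₂ _+_ (∑-cong (λ z → f≡g (true ∷ z))) (∑-cong (λ z → f≡g (false ∷ z)))

+-interchange : ∀ a b c d → (a + b) + (c + d) ≡ (a + c) + (b + d)
+-interchange = solve-∀

∑-distrib-+ : ∀ {s} (f g : Vec Bool s → ℕ) → ∑ (λ z → f z + g z) ≡ ∑ f + ∑ g
∑-distrib-+ {zero}  f g = refl
∑-distrib-+ {suc s} f g = trans
  (cong₂ _+_ (∑-distrib-+ (λ z → f (true ∷ z)) (λ z → g (true ∷ z)))
             (∑-distrib-+ (λ z → f (false ∷ z)) (λ z → g (false ∷ z))))
  (+-interchange (∑ (λ z → f (true ∷ z))) _ _ _)

∑-distribˡ-* : ∀ {s} k (f : Vec Bool s → ℕ) → ∑ (λ z → k * f z) ≡ k * ∑ f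
∑-distribˡ-* {zero}  k f = refl
∑-distribˡ-* {suc s} k f = trans
  (cong₂ _+_ (∑-distribˡ-* k (λ z → f (true ∷ z))) (∑-distribˡ-* k (λ z → f (false ∷ z))))
  (sym (*-distribˡ-+ k (∑ (λ z → f (true ∷ z))) _))

∑-const : ∀ s k → ∑ {s} (λ _ → k) ≡ 2 ^ s * k
∑-const zero    k = sym (+-identityʳ k)
∑-const (suc s) k = trans (cong₂ _+_ (∑-const s k) (∑-const s k)) (double (2 ^ s) k)
  where
  double : ∀ a k → a * k + a * k ≡ 2 * a * k
  double = solve-∀

∑-sum-swap : ∀ {s} {I : Set} (f : I → Vec Bool s → ℕ) is →
  ∑ (λ z → sum (map (λ i → f i z) is)) ≡ sum (map (λ i → ∑ (f i)) is)
∑-sum-swap {s} f []       = trans (∑-const s 0) (*-zeroʳ (2 ^ s))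
∑-sum-swap     f (i ∷ is) = trans (∑-distrib-+ (f i) _) (cong (∑ (f i) +_) (∑-sum-swap f is))

∑≡0⊎pos : ∀ {s} (f : Vec Bool s → ℕ) → ∑ f ≡ 0 ⊎ ∃ λ z → 0 < f z
∑≡0⊎pos {zero} f with f [] in eq
... | zero  = inj₁ refl
... | suc _ = inj₂ ([] , subst (0 <_) (sym eq) z<s)
∑≡0⊎pos {suc s} f with ∑≡0⊎pos (λ z → f (true ∷ z)) | ∑≡0⊎pos (λ z → f (false ∷ z))
... | inj₂ (z , p) | _            = inj₂ (true ∷ z , p)
... | inj₁ _       | inj₂ (z , p) = inj₂ (false ∷ z , p)
... | inj₁ p       | inj₁ q       = inj₁ (cong₂ _+_ p q)

sum-map-mono : ∀ {I : Set} {f g : I → ℕ} (is : List I) → (∀ i → f i ≤ g i) →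
  sum (map f is) ≤ sum (map g is)
sum-map-mono []       f≤g = z≤n
sum-map-mono (i ∷ is) f≤g = +-mono-≤ (f≤g i) (sum-map-mono is f≤g)

sum-map-const : ∀ {I : Set} k (is : List I) → sum (map (λ _ → k) is) ≡ length is * k
sum-map-const k []       = refl
sum-map-const k (i ∷ is) = cong (k +_) (sum-map-const k is)

∈⇒≤sum : ∀ {I : Set} (f : I → ℕ) {i is} → i ∈ˡ is → f i ≤ sum (map f is)
∈⇒≤sum f {is = _ ∷ is} (here refl) = m≤m+n _ _
∈⇒≤sum f {is = j ∷ is} (there i∈) = ≤-trans (∈⇒≤sum f i∈) (m≤n+m _ (f j))

⟦_⟧ : ∀ {P : Set} → Dec P → ℕ
⟦ yes _ ⟧ = 1
⟦ no  _ ⟧ = 0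

⟦⟧-mono : ∀ {P Q : Set} → (P → Q) → (P? : Dec P) (Q? : Dec Q) → ⟦ P? ⟧ ≤ ⟦ Q? ⟧
⟦⟧-mono f (no  _) _       = z≤n
⟦⟧-mono f (yes p) (yes _) = ≤-refl
⟦⟧-mono f (yes p) (no ¬q) = contradiction (f p) ¬q

⟦⟧-true : ∀ {P : Set} → P → (P? : Dec P) → 1 ≤ ⟦ P? ⟧
⟦⟧-true p (yes _) = ≤-refl
⟦⟧-true p (no ¬p) = contradiction p ¬p

⟦⟧-pos : ∀ {P : Set} (P? : Dec P) → 0 < ⟦ P? ⟧ → P
⟦⟧-pos (yes p) _ = p

-- Moments of correlations of sign vectors.

sgn : Bool → ℤ
sgn true  = ℤ.-1ℤ
sgn false = ℤ.1ℤ

-- The inner product of z and v read as ±1 vectors, with `true` standing for -1; it equals s minus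
-- twice their Hamming distance.
corr : ∀ {s} → Vec Bool s → Vec Bool s → ℤ
corr []      []      = 0ℤ
corr (a ∷ z) (c ∷ v) = sgn (a xor c) ℤ.+ corr z v

dist : ∀ {s} → Vec Bool s → Vec Bool s → ℕ
dist z v = weight (z ⊕ v)

infixr 8 _^²

_^² : ℕ → ℕ
m ^² = m * m

second-moment-step : ∀ x → ∣ ℤ.-1ℤ ℤ.+ x ∣ ^² + ∣ ℤ.1ℤ ℤ.+ x ∣ ^² ≡ 2 * ∣ x ∣ ^² + 2
second-moment-step (ℤ.+ zero)        = refl
second-moment-step (ℤ.+ suc m)       = lemma m
  where
  lemma : ∀ m → m * m + suc (suc m) * suc (suc m) ≡ 2 * (suc m * suc m) + 2
  lemma = solve-∀
second-moment-step -[1+ zero ]     = refl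
second-moment-step -[1+ suc m ]    = lemma m
  where
  lemma : ∀ m → suc (suc (suc m)) * suc (suc (suc m)) + suc m * suc m
              ≡ 2 * (suc (suc m) * suc (suc m)) + 2
  lemma = solve-∀

fourth-moment-step : ∀ x → ∣ ℤ.-1ℤ ℤ.+ x ∣ ^ 4 + ∣ ℤ.1ℤ ℤ.+ x ∣ ^ 4 ≡ 2 * ∣ x ∣ ^ 4 + (12 * ∣ x ∣ ^² + 2)
fourth-moment-step (ℤ.+ zero)        = refl
fourth-moment-step (ℤ.+ suc m)       = lemma m
  where
  lemma : ∀ m → m * (m * (m * (m * 1))) + (2 + m) * ((2 + m) * ((2 + m) * ((2 + m) * 1)))
              ≡ 2 * ((1 + m) * ((1 + m) * ((1 + m) * ((1 + m) * 1)))) + (12 * (suc m * suc m) + 2)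
  lemma = solve-∀
fourth-moment-step -[1+ zero ]     = refl
fourth-moment-step -[1+ suc m ]    = lemma m
  where
  lemma : ∀ m → (3 + m) * ((3 + m) * ((3 + m) * ((3 + m) * 1))) + (1 + m) * ((1 + m) * ((1 + m) * ((1 + m) * 1)))
              ≡ 2 * ((2 + m) * ((2 + m) * ((2 + m) * ((2 + m) * 1)))) + (12 * (suc (suc m) * suc (suc m)) + 2)
  lemma = solve-∀

-- The first sign of z takes both values, so the first entry of v only decides which half of the
-- cube contributes which term.
∑-corr-cons : ∀ {s} (f : ℤ → ℕ) (c : Bool) (v : Vec Bool s) →
  ∑ (λ z → f (corr z (c ∷ v))) ≡ ∑ (λ z → f (ℤ.-1ℤ ℤ.+ corr z v) + f (ℤ.1ℤ ℤ.+ corr z v))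
∑-corr-cons f false v = sym (∑-distrib-+ (λ z → f (ℤ.-1ℤ ℤ.+ corr z v)) _)
∑-corr-cons f true  v = trans (+-comm (∑ (λ z → f (ℤ.1ℤ ℤ.+ corr z v))) _)
  (sym (∑-distrib-+ (λ z → f (ℤ.-1ℤ ℤ.+ corr z v)) _))

second-moment : ∀ {s} (v : Vec Bool s) → ∑ (λ z → ∣ corr z v ∣ ^²) ≡ s * 2 ^ s
second-moment []              = refl
second-moment {suc s} (c ∷ v) = begin
  ∑ (λ z → ∣ corr z (c ∷ v) ∣ ^²)     ≡⟨ ∑-corr-cons (λ x → ∣ x ∣ ^²) c v ⟩
  _                                   ≡⟨ ∑-cong (λ z → second-moment-step (corr z v)) ⟩
  ∑ (λ z → 2 * ∣ corr z v ∣ ^² + 2)   ≡⟨ ∑-distrib-+ (λ z → 2 * ∣ corr z v ∣ ^²) _ ⟩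
  _                                   ≡⟨ cong₂ _+_ (∑-distribˡ-* 2 (λ z → ∣ corr z v ∣ ^²)) (∑-const s 2) ⟩
  2 * ∑ (λ z → ∣ corr z v ∣ ^²) + 2 ^ s * 2
                                      ≡⟨ cong (λ t → 2 * t + 2 ^ s * 2) (second-moment v) ⟩
  2 * (s * 2 ^ s) + 2 ^ s * 2         ≡⟨ lemma s (2 ^ s) ⟩
  suc s * 2 ^ suc s                   ∎
  where
  open ≡-Reasoning
  lemma : ∀ s p → 2 * (s * p) + p * 2 ≡ suc s * (2 * p)
  lemma = solve-∀

-- Odd powers cancel between the two signs of a new coordinate, so the mean fourth power grows by 6s
-- + 1; its exact value is 3s² - 2s.
fourth-moment : ∀ {s} (v : Vec Bool s) → ∑ (λ z → ∣ corr z v ∣ ^ 4) ≤ 3 * s ^² * 2 ^ s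
fourth-moment []              = z≤n
fourth-moment {suc s} (c ∷ v) = begin
  ∑ (λ z → ∣ corr z (c ∷ v) ∣ ^ 4)    ≡⟨ ∑-corr-cons (λ x → ∣ x ∣ ^ 4) c v ⟩
  _                                   ≡⟨ ∑-cong (λ z → fourth-moment-step (corr z v)) ⟩
  ∑ (λ z → 2 * ∣ corr z v ∣ ^ 4 + (12 * ∣ corr z v ∣ ^² + 2))
                                      ≡⟨ ∑-distrib-+ (λ z → 2 * ∣ corr z v ∣ ^ 4) _ ⟩
  _                                   ≡⟨ cong₂ _+_ (∑-distribˡ-* 2 (λ z → ∣ corr z v ∣ ^ 4))
                                           (∑-distrib-+ (λ z → 12 * ∣ corr z v ∣ ^²) _) ⟩
  2 * ∑ (λ z → ∣ corr z v ∣ ^ 4) + (∑ (λ z → 12 * ∣ corr z v ∣ ^²) + ∑ {s} (λ _ → 2))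
                                      ≡⟨ cong₂ (λ a b → 2 * ∑ (λ z → ∣ corr z v ∣ ^ 4) + (a + b))
                                           (trans (∑-distribˡ-* 12 (λ z → ∣ corr z v ∣ ^²))
                                                  (cong (12 *_) (second-moment v)))
                                           (∑-const s 2) ⟩
  2 * ∑ (λ z → ∣ corr z v ∣ ^ 4) + (12 * (s * 2 ^ s) + 2 ^ s * 2)
                                      ≤⟨ +-monoˡ-≤ _ (*-monoʳ-≤ 2 (fourth-moment v)) ⟩
  2 * (3 * s ^² * 2 ^ s) + (12 * (s * 2 ^ s) + 2 ^ s * 2)
                                      -- 3(s + 1)² exceeds 3s² by 6s + 3. The surplus of 2 over the
                                      -- required increment, times 2·2ˢ, is the added term.
                                      ≤⟨ m≤m+n _ (4 * 2 ^ s) ⟩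
  2 * (3 * s ^² * 2 ^ s) + (12 * (s * 2 ^ s) + 2 ^ s * 2) + 4 * 2 ^ s
                                      ≡⟨ lemma s (2 ^ s) ⟩
  3 * suc s ^² * 2 ^ suc s            ∎
  where
  open ≤-Reasoning
  lemma : ∀ s p → 2 * (3 * (s * s) * p) + (12 * (s * p) + p * 2) + 4 * p
                ≡ 3 * (suc s * suc s) * (2 * p)
  lemma = solve-∀

-- Counting lists of bounded sum.

bump : List ℕ → List ℕ
bump []       = []
bump (k ∷ ks) = suc k ∷ ks

-- All lists of length L with sum at most q.
compositions : ℕ → ℕ → List (List ℕ)
compositions zero    q       = [] ∷ []
compositions (suc L) zero    = map (0 ∷_) (compositions L zero)
compositions (suc L) (suc q) =
  map (0 ∷_) (compositions L (suc q)) ++ map bump (compositions (suc L) q)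

∈-compositions : ∀ q ks → sum ks ≤ q → ks ∈ˡ compositions (length ks) q
∈-compositions q       []           _        = here refl
∈-compositions zero    (zero ∷ ks)  h        = ∈-map⁺ (0 ∷_) (∈-compositions zero ks h)
∈-compositions (suc q) (zero ∷ ks)  h        = ∈-++⁺ˡ (∈-map⁺ (0 ∷_) (∈-compositions (suc q) ks h))
∈-compositions (suc q) (suc k ∷ ks) (s≤s h)  =
  ∈-++⁺ʳ (map (0 ∷_) (compositions (length ks) (suc q)))
    (∈-map⁺ bump (∈-compositions q (k ∷ ks) h))

-- The length is the binomial coefficient of L + q over q, and this is its exponential-moment bound
-- (2U)^q (1 + 1/U)^L with denominators cleared. The induction follows Pascal's rule, as
-- `compositions` does.
length-compositions : ∀ U L q → 1 ≤ U →
  length (compositions L q) * U ^ L ≤ (2 * U) ^ q * suc U ^ L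
length-compositions U zero q 1≤U = *-monoˡ-≤ 1 (m^n>0 (2 * U) {{>-nonZero (*-mono-≤ {1} {2} (s≤s z≤n) 1≤U)}} q)
length-compositions U (suc L) zero 1≤U = begin
  length (map (0 ∷_) (compositions L 0)) * (U * U ^ L)
    ≡⟨ cong (_* (U * U ^ L)) (length-map (0 ∷_) (compositions L 0)) ⟩
  length (compositions L 0) * (U * U ^ L)   ≡⟨ lemma (length (compositions L 0)) U (U ^ L) ⟩
  U * (length (compositions L 0) * U ^ L)   ≤⟨ *-mono-≤ (n≤1+n U) (length-compositions U L 0 1≤U) ⟩
  suc U * (1 * suc U ^ L)                   ≡⟨ lemma′ (suc U) (suc U ^ L) ⟩
  1 * (suc U * suc U ^ L)                   ∎
  where
  open ≤-Reasoning
  lemma : ∀ a b c → a * (b * c) ≡ b * (a * c)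
  lemma = solve-∀
  lemma′ : ∀ a b → a * (1 * b) ≡ 1 * (a * b)
  lemma′ = solve-∀
length-compositions U (suc L) (suc q) 1≤U = begin
  length (map (0 ∷_) cs ++ map bump ds) * (U * U ^ L)
    ≡⟨ cong (_* (U * U ^ L)) (trans (length-++ (map (0 ∷_) cs))
         (cong₂ _+_ (length-map (0 ∷_) cs) (length-map bump ds))) ⟩
  (length cs + length ds) * (U * U ^ L)
    ≡⟨ lemma₁ (length cs) (length ds) U (U ^ L) ⟩
  U * (length cs * U ^ L) + length ds * (U * U ^ L)
    ≤⟨ +-mono-≤ (*-monoʳ-≤ U (length-compositions U L (suc q) 1≤U)) (length-compositions U (suc L) q 1≤U) ⟩
  U * (2 * U * P * V) + P * (suc U * V)
    ≡⟨ lemma₂ U P V ⟩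
  P * V * (2 * (U * U) + U + 1)
    ≤⟨ *-monoʳ-≤ (P * V) (+-monoʳ-≤ (2 * (U * U) + U) 1≤U) ⟩
  P * V * (2 * (U * U) + U + U)
    ≡⟨ lemma₃ U P V ⟩
  2 * U * P * (suc U * V) ∎
  where
  open ≤-Reasoning
  cs = compositions L (suc q)
  ds = compositions (suc L) q
  P = (2 * U) ^ q
  V = suc U ^ L
  lemma₁ : ∀ a b U p → (a + b) * (U * p) ≡ U * (a * p) + b * (U * p)
  lemma₁ = solve-∀
  lemma₂ : ∀ U P V → U * (2 * U * P * V) + P * (suc U * V) ≡ P * V * (2 * (U * U) + U + 1)
  lemma₂ = solve-∀
  lemma₃ : ∀ U P V → P * V * (2 * (U * U) + U + U) ≡ 2 * U * P * (suc U * V)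
  lemma₃ = solve-∀

any? : ∀ {s} {P : Vec Bool s → Set} → (∀ z → Dec (P z)) → Dec (∃ P)
any? {zero} P? with P? []
... | yes p = yes ([] , p)
... | no ¬p = no λ { ([] , p) → ¬p p }
any? {suc s} P? with any? (P? ∘ (true ∷_)) | any? (P? ∘ (false ∷_))
... | yes (z , p) | _           = yes (true ∷ z , p)
... | no _        | yes (z , p) = yes (false ∷ z , p)
... | no ¬t       | no ¬f       = no λ { (true ∷ z , p) → ¬t (z , p) ; (false ∷ z , p) → ¬f (z , p) }

^-distribʳ-* : ∀ m n k → (m * n) ^ k ≡ m ^ k * n ^ k
^-distribʳ-* m n zero    = refl
^-distribʳ-* m n (suc k) = trans (cong (m * n *_) (^-distribʳ-* m n k)) (lemma m n (m ^ k) (n ^ k))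
  where
  lemma : ∀ a b c d → a * b * (c * d) ≡ a * c * (b * d)
  lemma = solve-∀

^-cancelʳ-≤ : ∀ m {j k} → 1 < m → m ^ j ≤ m ^ k → j ≤ k
^-cancelʳ-≤ m 1<m h = ≮⇒≥ λ k<j → <⇒≱ (^-monoʳ-< m 1<m k<j) h

-- After division by (U + 1)^(k + 1) this is Bernoulli's inequality (1 - 1/(U + 1))^k ≥ 1 - k/(U +
-- 1).
bernoulli : ∀ U k → suc U ^ k * suc U ≤ U ^ k * suc U + k * suc U ^ k
bernoulli U zero    = m≤m+n (1 * suc U) 0
bernoulli U (suc k) = begin
  suc U * V * suc U                              ≡⟨ *-assoc (suc U) V (suc U) ⟩
  suc U * (V * suc U)                            ≤⟨ *-monoʳ-≤ (suc U) (bernoulli U k) ⟩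
  suc U * (W * suc U + k * V)                    ≡⟨ lemma₁ U V W k ⟩
  U * W * suc U + (suc U * W + k * (suc U * V))  ≤⟨ +-monoʳ-≤ (U * W * suc U) (+-monoˡ-≤ (k * (suc U * V))
                                                      (*-monoʳ-≤ (suc U) (^-monoˡ-≤ k (n≤1+n U)))) ⟩
  U * W * suc U + (suc U * V + k * (suc U * V))  ∎
  where
  open ≤-Reasoning
  V = suc U ^ k
  W = U ^ k
  lemma₁ : ∀ U V W k → suc U * (W * suc U + k * V) ≡ U * W * suc U + (suc U * W + k * (suc U * V))
  lemma₁ = solve-∀

-- Bernoulli gives (1 - 1/(2u + 1))^u ≥ 1 - u/(2u + 1) > 1/2.
[1+2u]^u≤2*[2u]^u : ∀ u → suc (2 * u) ^ u ≤ 2 * (2 * u) ^ u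
[1+2u]^u≤2*[2u]^u u = *-cancelʳ-≤ V (2 * W) (suc u) (+-cancelʳ-≤ (u * V) _ _ (begin
  V * suc u + u * V                ≡⟨ lemma₁ u V ⟩
  V * suc (2 * u)                  ≤⟨ bernoulli (2 * u) u ⟩
  W * suc (2 * u) + u * V          ≤⟨ +-monoˡ-≤ (u * V) (≤-trans (m≤m+n _ W) (≤-reflexive (lemma₂ u W))) ⟩
  2 * W * suc u + u * V            ∎))
  where
  open ≤-Reasoning
  V = suc (2 * u) ^ u
  W = (2 * u) ^ u
  lemma₁ : ∀ u V → V * suc u + u * V ≡ V * suc (2 * u)
  lemma₁ = solve-∀
  lemma₂ : ∀ u W → W * suc (2 * u) + W ≡ 2 * W * suc u
  lemma₂ = solve-∀

-- With U = 2u, every u entries of a list cost a factor of at most two, hence u·p entries at most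
-- 2^p, while each unit of the sum costs 4u.
length-compositions-≤ : ∀ u L q p .{{_ : NonZero u}} → L ≤ u * p →
  length (compositions L q) ≤ (4 * u) ^ q * 2 ^ p
length-compositions-≤ u L q p L≤up = *-cancelʳ-≤ N _ (U ^ (u * p)) {{m^n≢0 U (u * p)}} (begin
  N * U ^ (u * p)                    ≡⟨ cong (λ k → N * U ^ k) (sym L+e) ⟩
  N * U ^ (L + e)                    ≡⟨ cong (N *_) (^-distribˡ-+-* U L e) ⟩
  N * (U ^ L * U ^ e)                ≡⟨ *-assoc N (U ^ L) (U ^ e) ⟨
  N * U ^ L * U ^ e                  ≤⟨ *-mono-≤ (length-compositions U L q (>-nonZero⁻¹ U))
                                                  (^-monoˡ-≤ e (n≤1+n U)) ⟩
  P * suc U ^ L * suc U ^ e          ≡⟨ *-assoc P (suc U ^ L) (suc U ^ e) ⟩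
  P * (suc U ^ L * suc U ^ e)        ≡⟨ cong (P *_) (^-distribˡ-+-* (suc U) L e) ⟨
  P * suc U ^ (L + e)                ≡⟨ cong (λ k → P * suc U ^ k) L+e ⟩
  P * suc U ^ (u * p)                ≡⟨ cong (P *_) (^-*-assoc (suc U) u p) ⟨
  P * (suc U ^ u) ^ p                ≤⟨ *-monoʳ-≤ P (^-monoˡ-≤ p ([1+2u]^u≤2*[2u]^u u)) ⟩
  P * (2 * U ^ u) ^ p                ≡⟨ cong (P *_) (^-distribʳ-* 2 (U ^ u) p) ⟩
  P * (2 ^ p * (U ^ u) ^ p)          ≡⟨ cong (λ k → P * (2 ^ p * k)) (^-*-assoc U u p) ⟩
  P * (2 ^ p * U ^ (u * p))          ≡⟨ *-assoc P (2 ^ p) (U ^ (u * p)) ⟨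
  P * 2 ^ p * U ^ (u * p)            ≡⟨ cong (λ k → k ^ q * 2 ^ p * U ^ (u * p)) (sym (*-assoc 2 2 u)) ⟩
  (4 * u) ^ q * 2 ^ p * U ^ (u * p)  ∎)
  where
  open ≤-Reasoning
  U = 2 * u
  instance
    U≢0 : NonZero U
    U≢0 = m*n≢0 2 u
  P = (2 * U) ^ q
  N = length (compositions L q)
  e = u * p ∸ L
  L+e : L + e ≡ u * p
  L+e = m+[n∸m]≡n L≤up

-- Hamming balls of radius s/16.

agree : ∀ {s} → Vec Bool s → Vec Bool s → ℕ
agree []      []      = 0
agree (a ∷ z) (c ∷ v) = if a xor c then agree z v else suc (agree z v)

agree+dist : ∀ {s} (z v : Vec Bool s) → agree z v + dist z v ≡ s
agree+dist []          []          = refl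
agree+dist (true  ∷ z) (true  ∷ v) = cong suc (agree+dist z v)
agree+dist (true  ∷ z) (false ∷ v) = trans (+-suc (agree z v) _) (cong suc (agree+dist z v))
agree+dist (false ∷ z) (true  ∷ v) = trans (+-suc (agree z v) _) (cong suc (agree+dist z v))
agree+dist (false ∷ z) (false ∷ v) = cong suc (agree+dist z v)

-- The sum is a product over coordinates, in which agreement contributes 4 and disagreement 1.
∑-4^agree : ∀ {s} (v : Vec Bool s) → ∑ (λ z → 4 ^ agree z v) ≡ 5 ^ s
∑-4^agree []          = refl
∑-4^agree {suc s} (true  ∷ v) rewrite ∑-distribˡ-* 4 (λ z → 4 ^ agree z v) | ∑-4^agree v = +-comm (4 * 5 ^ s) (5 ^ s)
∑-4^agree (false ∷ v) rewrite ∑-distribˡ-* 4 (λ z → 4 ^ agree z v) | ∑-4^agree v = refl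

-- A Chernoff bound with weight 4 per agreement: a point of the ball disagrees with v in at most
-- `s div 16` coordinates, so its weight is at least 4^(s ∸ s div 16).
ball-count : ∀ {s} (v : Vec Bool s) → ∑ (λ z → ⟦ 16 * dist z v ≤? s ⟧) * 4 ^ (s ∸ s div 16) ≤ 5 ^ s
ball-count {s} v = begin
  ∑ (λ z → ⟦ 16 * dist z v ≤? s ⟧) * P    ≡⟨ *-comm _ P ⟩
  P * ∑ (λ z → ⟦ 16 * dist z v ≤? s ⟧)    ≡⟨ ∑-distribˡ-* P (λ z → ⟦ 16 * dist z v ≤? s ⟧) ⟨
  ∑ (λ z → P * ⟦ 16 * dist z v ≤? s ⟧)    ≤⟨ ∑-mono-≤ pointwise ⟩
  ∑ (λ z → 4 ^ agree z v)                 ≡⟨ ∑-4^agree v ⟩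
  5 ^ s                                   ∎
  where
  open ≤-Reasoning
  P = 4 ^ (s ∸ s div 16)
  pointwise : ∀ z → P * ⟦ 16 * dist z v ≤? s ⟧ ≤ 4 ^ agree z v
  pointwise z with 16 * dist z v ≤? s
  ... | no  _ = ≤-trans (≤-reflexive (*-zeroʳ P)) z≤n
  ... | yes h = ≤-trans (≤-reflexive (*-identityʳ P)) (^-monoʳ-≤ 4 (begin
    s ∸ s div 16                               ≤⟨ ∸-monoʳ-≤ s d≤ ⟩
    s ∸ dist z v                               ≡⟨ cong (_∸ dist z v) (agree+dist z v) ⟨
    agree z v + dist z v ∸ dist z v            ≡⟨ m+n∸n≡m (agree z v) (dist z v) ⟩
    agree z v                                  ∎))
    where
    d≤ : dist z v ≤ s div 16
    d≤ = ≮⇒≥ λ lt → <⇒≱ (begin-strict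
      s                               ≡⟨ m≡m%n+[m/n]*n s 16 ⟩
      s mod 16 + s div 16 * 16        <⟨ +-monoˡ-< (s div 16 * 16) (m%n<n s 16) ⟩
      suc (s div 16) * 16             ≤⟨ *-monoˡ-≤ 16 lt ⟩
      dist z v * 16                   ≡⟨ *-comm (dist z v) 16 ⟩
      16 * dist z v                   ∎) h

-- Labels of rounded correlations.

_⁺ : ℤ → ℕ
(ℤ.+ m) ⁺    = m
-[1+ m ] ⁺ = 0

div-≡⇒≤+ : ∀ b .{{_ : NonZero b}} m k → m div b ≡ k div b → m ≤ k + b
div-≡⇒≤+ b m k eq = begin
  m                          ≡⟨ m≡m%n+[m/n]*n m b ⟩
  m mod b + m div b * b      ≤⟨ +-mono-≤ (<⇒≤ (m%n<n m b)) (≤-reflexive (cong (_* b) eq)) ⟩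
  b + k div b * b            ≤⟨ +-monoʳ-≤ b (m/n*n≤m k b) ⟩
  b + k                      ≡⟨ +-comm b k ⟩
  k + b                      ∎
  where open ≤-Reasoning

∣⊖∣-≤+ : ∀ m k b → m ≤ k + b → k ≤ m + b → ∣ m ℤ.⊖ k ∣ ≤ b
∣⊖∣-≤+ m k b m≤ k≤ with ≤-total m k
... | inj₁ m≤k = subst (_≤ b) (sym (ℤ.∣⊖∣-≤ m≤k)) (m≤n+o⇒m∸n≤o k m k≤)
... | inj₂ k≤m = subst (_≤ b) (sym (trans (ℤ.∣m⊖n∣≡∣n⊖m∣ m k) (ℤ.∣⊖∣-≤ k≤m))) (m≤n+o⇒m∸n≤o m k m≤)

div-≡⇒close : ∀ b .{{_ : NonZero b}} m k → m div b ≡ k div b → ∣ m ℤ.⊖ k ∣ ≤ b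
div-≡⇒close b m k eq = ∣⊖∣-≤+ m k b (div-≡⇒≤+ b m k eq) (div-≡⇒≤+ b k m (sym eq))

⁺-split : ∀ x → x ≡ ℤ.+ (x ⁺) ℤ.- ℤ.+ ((ℤ.- x) ⁺)
⁺-split (ℤ.+ zero)  = refl
⁺-split (ℤ.+ suc m) = sym (ℤ.+-identityʳ _)
⁺-split -[1+ m ]    = refl

-- Positive and negative parts each differ by at most b, whence the width b + b.
⁺-div-≡⇒close : ∀ b .{{_ : NonZero b}} x y → x ⁺ div b ≡ y ⁺ div b →
  (ℤ.- x) ⁺ div b ≡ (ℤ.- y) ⁺ div b → ∣ x ℤ.- y ∣ ≤ b + b
⁺-div-≡⇒close b x y p n = begin
  ∣ x ℤ.- y ∣
    ≡⟨ cong ∣_∣ (trans (cong₂ ℤ._-_ (⁺-split x) (⁺-split y)) (rearrange (ℤ.+ (x ⁺)) (ℤ.+ ((ℤ.- x) ⁺)) (ℤ.+ (y ⁺)) (ℤ.+ ((ℤ.- y) ⁺)))) ⟩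
  ∣ (ℤ.+ (x ⁺) ℤ.- ℤ.+ (y ⁺)) ℤ.- (ℤ.+ ((ℤ.- x) ⁺) ℤ.- ℤ.+ ((ℤ.- y) ⁺)) ∣
    ≤⟨ ℤ.∣i-j∣≤∣i∣+∣j∣ (ℤ.+ (x ⁺) ℤ.- ℤ.+ (y ⁺)) _ ⟩
  ∣ ℤ.+ (x ⁺) ℤ.- ℤ.+ (y ⁺) ∣ + ∣ ℤ.+ ((ℤ.- x) ⁺) ℤ.- ℤ.+ ((ℤ.- y) ⁺) ∣
    ≡⟨ cong₂ (λ i j → ∣ i ∣ + ∣ j ∣) (ℤ.m-n≡m⊖n (x ⁺) (y ⁺)) (ℤ.m-n≡m⊖n ((ℤ.- x) ⁺) ((ℤ.- y) ⁺)) ⟩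
  ∣ x ⁺ ℤ.⊖ y ⁺ ∣ + ∣ (ℤ.- x) ⁺ ℤ.⊖ (ℤ.- y) ⁺ ∣
    ≤⟨ +-mono-≤ (div-≡⇒close b (x ⁺) (y ⁺) p) (div-≡⇒close b ((ℤ.- x) ⁺) ((ℤ.- y) ⁺) n) ⟩
  b + b ∎
  where
  open ≤-Reasoning
  rearrange : ∀ a b c d → (a ℤ.- b) ℤ.- (c ℤ.- d) ≡ (a ℤ.- c) ℤ.- (b ℤ.- d)
  rearrange = ℤ-solve-∀

m≤m^4 : ∀ m → m ≤ m ^ 4
m≤m^4 zero    = z≤n
m≤m^4 (suc m) = ≤-trans (≤-reflexive (sym (*-identityʳ (suc m)))) (*-monoʳ-≤ (suc m) (m^n>0 (suc m) 3))

b^4*[m/b]≤m^4 : ∀ b .{{_ : NonZero b}} m → b ^ 4 * (m div b) ≤ m ^ 4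
b^4*[m/b]≤m^4 b m = begin
  b ^ 4 * (m div b)       ≤⟨ *-monoʳ-≤ (b ^ 4) (m≤m^4 (m div b)) ⟩
  b ^ 4 * (m div b) ^ 4   ≡⟨ ^-distribʳ-* b (m div b) 4 ⟨
  (b * (m div b)) ^ 4     ≡⟨ cong (_^ 4) (*-comm b (m div b)) ⟩
  (m div b * b) ^ 4       ≤⟨ ^-monoˡ-≤ 4 (m/n*n≤m m b) ⟩
  m ^ 4                   ∎
  where open ≤-Reasoning

-- One of the two parts is zero, and a quotient is at most its own fourth power. Thus a
-- fourth-moment bound controls the sum of the labels.
label-weight : ∀ b .{{_ : NonZero b}} x → b ^ 4 * (x ⁺ div b + (ℤ.- x) ⁺ div b) ≤ ∣ x ∣ ^ 4
label-weight b x = ≤-trans (≤-reflexive (*-distribˡ-+ (b ^ 4) (x ⁺ div b) _))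
  (≤-trans (+-mono-≤ (b^4*[m/b]≤m^4 b (x ⁺)) (b^4*[m/b]≤m^4 b ((ℤ.- x) ⁺))) (powers x))
  where
  powers : ∀ x → (x ⁺) ^ 4 + ((ℤ.- x) ⁺) ^ 4 ≤ ∣ x ∣ ^ 4
  powers (ℤ.+ zero)  = z≤n
  powers (ℤ.+ suc m) = ≤-reflexive (+-identityʳ (suc m ^ 4))
  powers -[1+ m ]    = ≤-refl

module Labels (b : ℕ) .{{_ : NonZero b}} where

  -- Positive and negative parts are rounded separately to keep the labels natural numbers. Both
  -- vanish for a correlation of absolute value below b, so only large correlations contribute to
  -- the sum.
  labels : ∀ {s} → List (Vec Bool s) → Vec Bool s → List ℕ
  labels []      z = []
  labels (v ∷ R) z = corr z v ⁺ div b ∷ (ℤ.- corr z v) ⁺ div b ∷ labels R z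

  length-labels : ∀ {s} (R : List (Vec Bool s)) z → length (labels R z) ≡ length R * 2
  length-labels []      z = refl
  length-labels (v ∷ R) z = cong (2 +_) (length-labels R z)

  labels-≡⇒close : ∀ {s} (R : List (Vec Bool s)) z z′ → labels R z ≡ labels R z′ →
    ∀ {v} → v ∈ˡ R → ∣ corr z v ℤ.- corr z′ v ∣ ≤ b + b
  labels-≡⇒close (v ∷ R) z z′ eq v∈ with List.∷-injective eq
  ... | e₁ , eq₁ with List.∷-injective eq₁
  labels-≡⇒close (v ∷ R) z z′ eq (here refl) | e₁ , _ | e₂ , _   = ⁺-div-≡⇒close b (corr z v) (corr z′ v) e₁ e₂
  labels-≡⇒close (v ∷ R) z z′ eq (there v∈)  | _ , _  | _  , eq₂ = labels-≡⇒close R z z′ eq₂ v∈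

  sum-labels : ∀ {s} (R : List (Vec Bool s)) z →
    b ^ 4 * sum (labels R z) ≤ sum (map (λ v → ∣ corr z v ∣ ^ 4) R)
  sum-labels []      z = ≤-reflexive (*-zeroʳ (b ^ 4))
  sum-labels (v ∷ R) z = ≤-trans
    (≤-reflexive (trans (cong (b ^ 4 *_) (sym (+-assoc (corr z v ⁺ div b) _ _)))
                        (*-distribˡ-+ (b ^ 4) (corr z v ⁺ div b + _) _)))
    (+-mono-≤ (label-weight b (corr z v)) (sum-labels R z))

-- Partial colouring by pigeonhole.

module PartialColouring {s} (R : List (Vec Bool s)) (b : ℕ) .{{_ : NonZero b}} (q : ℕ) where
  open Labels b

  small? : ∀ z → Dec (sum (labels R z) ≤ q)
  small? z = sum (labels R z) ≤? q

  -- Markov's inequality: a label sum above q forces a sum of fourth powers of at least (q + 1)b⁴,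
  -- while the mean of that sum is at most 3s² times the length of R, by hypothesis at most half as
  -- much.
  half-small : 6 * length R * s ^² ≤ suc q * b ^ 4 → 2 ^ s ≤ 2 * ∑ (λ z → ⟦ small? z ⟧)
  half-small h = *-cancelˡ-≤ E {{m*n≢0 (suc q) (b ^ 4) {{_}} {{m^n≢0 b 4}}}}
    (+-cancelʳ-≤ (E * 2 ^ s) _ _ (begin
      E * 2 ^ s + E * 2 ^ s                      ≡⟨ lemma₁ E (2 ^ s) ⟩
      2 * (2 ^ s * E)                            ≡⟨ cong (2 *_) (∑-const s E) ⟨
      2 * ∑ {s} (λ _ → E)                        ≤⟨ *-monoʳ-≤ 2 (∑-mono-≤ pointwise) ⟩
      2 * ∑ (λ z → E * ⟦ small? z ⟧ + sum (map (λ v → ∣ corr z v ∣ ^ 4) R))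
                                                 ≡⟨ cong (2 *_) (trans (∑-distrib-+ (λ z → E * ⟦ small? z ⟧) _)
                                                      (cong₂ _+_ (∑-distribˡ-* E (λ z → ⟦ small? z ⟧))
                                                         (∑-sum-swap (λ v z → ∣ corr z v ∣ ^ 4) R))) ⟩
      2 * (E * G + sum (map (λ v → ∑ (λ z → ∣ corr z v ∣ ^ 4)) R))
                                                 ≤⟨ *-monoʳ-≤ 2 (+-monoʳ-≤ (E * G)
                                                      (≤-trans (sum-map-mono R fourth-moment)
                                                         (≤-reflexive (sum-map-const (3 * s ^² * 2 ^ s) R)))) ⟩
      2 * (E * G + length R * (3 * s ^² * 2 ^ s)) ≡⟨ lemma₂ E G (length R) (s ^²) (2 ^ s) ⟩
      E * (2 * G) + 6 * length R * s ^² * 2 ^ s  ≤⟨ +-monoʳ-≤ (E * (2 * G)) (*-monoˡ-≤ (2 ^ s) h) ⟩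
      E * (2 * G) + E * 2 ^ s                    ∎))
    where
    open ≤-Reasoning
    E = suc q * b ^ 4
    G = ∑ (λ z → ⟦ small? z ⟧)
    lemma₁ : ∀ E p → E * p + E * p ≡ 2 * (p * E)
    lemma₁ = solve-∀
    lemma₂ : ∀ E G M t p → 2 * (E * G + M * (3 * t * p)) ≡ E * (2 * G) + 6 * M * t * p
    lemma₂ = solve-∀
    pointwise : ∀ z → E ≤ E * ⟦ small? z ⟧ + sum (map (λ v → ∣ corr z v ∣ ^ 4) R)
    pointwise z with small? z
    ... | yes _ = ≤-trans (≤-reflexive (sym (*-identityʳ E))) (m≤m+n _ _)
    ... | no ¬p = begin
      suc q * b ^ 4                  ≤⟨ *-monoˡ-≤ (b ^ 4) (≰⇒> ¬p) ⟩
      sum (labels R z) * b ^ 4       ≡⟨ *-comm (sum (labels R z)) (b ^ 4) ⟩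
      b ^ 4 * sum (labels R z)       ≤⟨ sum-labels R z ⟩
      _                              ≤⟨ m≤n+m _ (E * 0) ⟩
      E * 0 + _                      ∎

  _≟ˡ_ : (ks ls : List ℕ) → Dec (ks ≡ ls)
  _≟ˡ_ = List.≡-dec _≟_

  Far : Vec Bool s → Vec Bool s → Set
  Far z z′ = labels R z ≡ labels R z′ × s < 16 * dist z z′

  -- Without a far pair, a nonempty label class lies in the ball of radius s/16 about any of its
  -- members.
  class-count : ¬ (∃₂ Far) → ∀ ks → ∑ (λ z → ⟦ labels R z ≟ˡ ks ⟧) * 4 ^ (s ∸ s div 16) ≤ 5 ^ s
  class-count ¬far ks with ∑≡0⊎pos (λ z → ⟦ labels R z ≟ˡ ks ⟧)
  ... | inj₁ ≡0 = subst (λ t → t * 4 ^ (s ∸ s div 16) ≤ 5 ^ s) (sym ≡0) z≤n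
  ... | inj₂ (z₀ , pos) = ≤-trans
    (*-monoˡ-≤ (4 ^ (s ∸ s div 16)) (∑-mono-≤ λ z →
      ⟦⟧-mono (λ eq → ≮⇒≥ λ far → ¬far (z , z₀ , trans eq (sym eq₀) , far))
        (labels R z ≟ˡ ks) (16 * dist z z₀ ≤? s)))
    (ball-count z₀)
    where
    eq₀ : labels R z₀ ≡ ks
    eq₀ = ⟦⟧-pos (labels R z₀ ≟ˡ ks) pos

  -- The label list of a small z occurs in `compositions`, so the class bounds add up over that
  -- list.
  small-count : ¬ (∃₂ Far) →
    ∑ (λ z → ⟦ small? z ⟧) * 4 ^ (s ∸ s div 16) ≤ length (compositions (length R * 2) q) * 5 ^ s
  small-count ¬far = begin
    ∑ (λ z → ⟦ small? z ⟧) * P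
      ≤⟨ *-monoˡ-≤ P (∑-mono-≤ pointwise) ⟩
    ∑ (λ z → sum (map (λ ks → ⟦ labels R z ≟ˡ ks ⟧) cs)) * P
      ≡⟨ cong (_* P) (∑-sum-swap (λ ks z → ⟦ labels R z ≟ˡ ks ⟧) cs) ⟩
    sum (map (λ ks → ∑ (λ z → ⟦ labels R z ≟ˡ ks ⟧)) cs) * P
      ≤⟨ bound cs ⟩
    length cs * 5 ^ s ∎
    where
    open ≤-Reasoning
    P = 4 ^ (s ∸ s div 16)
    cs = compositions (length R * 2) q
    pointwise : ∀ z → ⟦ small? z ⟧ ≤ sum (map (λ ks → ⟦ labels R z ≟ˡ ks ⟧) cs)
    pointwise z with small? z
    ... | no  _ = z≤n
    ... | yes h = ≤-trans (⟦⟧-true refl (labels R z ≟ˡ labels R z))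
      (∈⇒≤sum (λ ks → ⟦ labels R z ≟ˡ ks ⟧)
        (subst (λ L → labels R z ∈ˡ compositions L q) (length-labels R z) (∈-compositions q (labels R z) h)))
    bound : ∀ cs → sum (map (λ ks → ∑ (λ z → ⟦ labels R z ≟ˡ ks ⟧)) cs) * P ≤ length cs * 5 ^ s
    bound []       = z≤n
    bound (c ∷ cs) = ≤-trans (≤-reflexive (*-distribʳ-+ P (∑ (λ z → ⟦ labels R z ≟ˡ c ⟧)) _))
      (+-mono-≤ (class-count ¬far c) (bound cs))

  -- At least half of the cube is divided among at most 2^h label classes. If each fitted into a
  -- ball of radius s/16, then 2^s·4^a ≤ 2^(1 + h)·5^s would force s ≤ 2 + 2h.
  far-pair : ∀ τ p → length R * 2 ≤ 2 ^ τ * p → 6 * length R * s ^² ≤ suc q * b ^ 4 →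
    2 + 2 * ((2 + τ) * q + p) < s → ∃₂ Far
  -- The cube can be searched exhaustively, so it suffices to refute the absence of such a pair.
  far-pair τ p L≤ weights s> = decidable-stable
    (any? λ z → any? λ z′ → (labels R z ≟ˡ labels R z′) ×-dec (s <? 16 * dist z z′))
    λ ¬far → <⇒≱ s> (final ¬far)
    where
    open ≤-Reasoning
    N = length (compositions (length R * 2) q)
    h = (2 + τ) * q + p
    a = s ∸ s div 16
    N≤ : N ≤ 2 ^ h
    N≤ = begin
      N                          ≤⟨ length-compositions-≤ (2 ^ τ) (length R * 2) q p {{m^n≢0 2 τ}} L≤ ⟩
      (4 * 2 ^ τ) ^ q * 2 ^ p    ≡⟨ cong (λ t → t ^ q * 2 ^ p) (^-distribˡ-+-* 2 2 τ) ⟨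
      (2 ^ (2 + τ)) ^ q * 2 ^ p  ≡⟨ cong (_* 2 ^ p) (^-*-assoc 2 (2 + τ) q) ⟩
      2 ^ ((2 + τ) * q) * 2 ^ p  ≡⟨ ^-distribˡ-+-* 2 ((2 + τ) * q) p ⟨
      2 ^ h                      ∎
    15s≤16a : 15 * s ≤ 16 * a
    15s≤16a = +-cancelʳ-≤ (s div 16 * 16) _ _ (begin
      15 * s + s div 16 * 16         ≤⟨ +-monoʳ-≤ (15 * s) (m/n*n≤m s 16) ⟩
      15 * s + s                     ≡⟨ lemma s ⟩
      16 * s                         ≤⟨ *-monoʳ-≤ 16 (m≤n+m∸n s (s div 16)) ⟩
      16 * (s div 16 + a)            ≡⟨ lemma′ (s div 16) a ⟩
      16 * a + s div 16 * 16         ∎)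
      where
      lemma : ∀ s → 15 * s + s ≡ 16 * s
      lemma = solve-∀
      lemma′ : ∀ d a → 16 * (d + a) ≡ 16 * a + d * 16
      lemma′ = solve-∀
    final : ¬ (∃₂ Far) → s ≤ 2 + 2 * h
    -- Sixteenth powers make the exponents integral: the left side contributes 16 + 2·15 = 46 per
    -- unit of s, and 5^16 ≤ 2^38 leaves 8 of them.
    final ¬far = *-cancelˡ-≤ 8 (+-cancelʳ-≤ (38 * s) _ _ (begin
      8 * s + 38 * s                   ≡⟨ *-distribʳ-+ s 8 38 ⟨
      46 * s                           ≤⟨ ^-cancelʳ-≤ 2 (s≤s (s≤s z≤n)) powers ⟩
      (1 + h) * 16 + 38 * s            ≡⟨ cong (_+ 38 * s) (lemma h) ⟩
      8 * (2 + 2 * h) + 38 * s         ∎))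
      where
      lemma : ∀ h → (1 + h) * 16 ≡ 8 * (2 + 2 * h)
      lemma = solve-∀
      counted : 2 ^ s * 4 ^ a ≤ 2 ^ (1 + h) * 5 ^ s
      counted = begin
        2 ^ s * 4 ^ a                               ≤⟨ *-monoˡ-≤ (4 ^ a) (half-small weights) ⟩
        2 * ∑ (λ z → ⟦ small? z ⟧) * 4 ^ a          ≡⟨ *-assoc 2 (∑ (λ z → ⟦ small? z ⟧)) (4 ^ a) ⟩
        2 * (∑ (λ z → ⟦ small? z ⟧) * 4 ^ a)        ≤⟨ *-monoʳ-≤ 2 (small-count ¬far) ⟩
        2 * (N * 5 ^ s)                             ≤⟨ *-monoʳ-≤ 2 (*-monoˡ-≤ (5 ^ s) N≤) ⟩
        2 * (2 ^ h * 5 ^ s)                         ≡⟨ *-assoc 2 (2 ^ h) (5 ^ s) ⟨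
        2 ^ (1 + h) * 5 ^ s                         ∎
      powers : 2 ^ (46 * s) ≤ 2 ^ ((1 + h) * 16 + 38 * s)
      powers = begin
        2 ^ (46 * s)                                ≡⟨ cong (2 ^_) (split s) ⟩
        2 ^ (s * 16 + 2 * (15 * s))                 ≤⟨ ^-monoʳ-≤ 2 (+-monoʳ-≤ (s * 16) (*-monoʳ-≤ 2 15s≤16a)) ⟩
        2 ^ (s * 16 + 2 * (16 * a))                 ≡⟨ cong (λ t → 2 ^ (s * 16 + t)) (swap a) ⟩
        2 ^ (s * 16 + 2 * a * 16)                   ≡⟨ ^-distribˡ-+-* 2 (s * 16) (2 * a * 16) ⟩
        2 ^ (s * 16) * 2 ^ (2 * a * 16)             ≡⟨ cong₂ _*_ (^-*-assoc 2 s 16) (^-*-assoc 2 (2 * a) 16) ⟨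
        (2 ^ s) ^ 16 * (2 ^ (2 * a)) ^ 16           ≡⟨ cong (λ t → (2 ^ s) ^ 16 * t ^ 16) (^-*-assoc 2 2 a) ⟨
        (2 ^ s) ^ 16 * (4 ^ a) ^ 16                 ≡⟨ ^-distribʳ-* (2 ^ s) (4 ^ a) 16 ⟨
        (2 ^ s * 4 ^ a) ^ 16                        ≤⟨ ^-monoˡ-≤ 16 counted ⟩
        (2 ^ (1 + h) * 5 ^ s) ^ 16                  ≡⟨ ^-distribʳ-* (2 ^ (1 + h)) (5 ^ s) 16 ⟩
        (2 ^ (1 + h)) ^ 16 * (5 ^ s) ^ 16           ≡⟨ cong₂ _*_ (^-*-assoc 2 (1 + h) 16)
                                                         (trans (^-*-assoc 5 s 16) (trans (cong (5 ^_) (*-comm s 16)) (sym (^-*-assoc 5 16 s)))) ⟩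
        2 ^ ((1 + h) * 16) * (5 ^ 16) ^ s           ≤⟨ *-monoʳ-≤ (2 ^ ((1 + h) * 16)) (^-monoˡ-≤ s (≤ᵇ⇒≤ (5 ^ 16) (2 ^ 38) _)) ⟩
        2 ^ ((1 + h) * 16) * (2 ^ 38) ^ s           ≡⟨ cong (2 ^ ((1 + h) * 16) *_) (^-*-assoc 2 38 s) ⟩
        2 ^ ((1 + h) * 16) * 2 ^ (38 * s)           ≡⟨ ^-distribˡ-+-* 2 ((1 + h) * 16) (38 * s) ⟨
        2 ^ ((1 + h) * 16 + 38 * s)                 ∎
        where
        split : ∀ s → 46 * s ≡ s * 16 + 2 * (15 * s)
        split = solve-∀
        swap : ∀ a → 2 * (16 * a) ≡ 2 * a * 16
        swap = solve-∀

-- Balancing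

-- `agree` computes coordinate by coordinate, so it can serve as the length of vectors on the
-- coordinates still uncoloured.
restrict : ∀ {s} (z z′ : Vec Bool s) → Vec Bool s → Vec Bool (agree z z′)
restrict []          []           []      = []
restrict (true  ∷ z) (true  ∷ z′) (c ∷ v) = c ∷ restrict z z′ v
restrict (true  ∷ z) (false ∷ z′) (c ∷ v) = restrict z z′ v
restrict (false ∷ z) (true  ∷ z′) (c ∷ v) = restrict z z′ v
restrict (false ∷ z) (false ∷ z′) (c ∷ v) = c ∷ restrict z z′ v

-- Half of z - z′, taken as sign vectors, is z where they differ and 0 elsewhere; the former
-- coordinates keep the colour from z, and w colours the rest.
merge : ∀ {s} (z z′ : Vec Bool s) → Vec Bool (agree z z′) → Vec Bool s
merge []          []           w       = []
merge (true  ∷ z) (true  ∷ z′) (a ∷ w) = a ∷ merge z z′ w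
merge (true  ∷ z) (false ∷ z′) w       = true ∷ merge z z′ w
merge (false ∷ z) (true  ∷ z′) w       = false ∷ merge z z′ w
merge (false ∷ z) (false ∷ z′) (a ∷ w) = a ∷ merge z z′ w

private
  keep : ∀ t u m w x y → m ℤ.+ m ≡ (w ℤ.+ w) ℤ.+ (x ℤ.- y) →
    (t ℤ.+ m) ℤ.+ (t ℤ.+ m) ≡ ((t ℤ.+ w) ℤ.+ (t ℤ.+ w)) ℤ.+ ((u ℤ.+ x) ℤ.- (u ℤ.+ y))
  keep t u m w x y eq = trans (lemma t m) (trans (cong (λ i → (t ℤ.+ t) ℤ.+ i) eq) (lemma′ t u w x y))
    where
    lemma : ∀ t m → (t ℤ.+ m) ℤ.+ (t ℤ.+ m) ≡ (t ℤ.+ t) ℤ.+ (m ℤ.+ m)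
    lemma = ℤ-solve-∀
    lemma′ : ∀ t u w x y → (t ℤ.+ t) ℤ.+ ((w ℤ.+ w) ℤ.+ (x ℤ.- y))
      ≡ ((t ℤ.+ w) ℤ.+ (t ℤ.+ w)) ℤ.+ ((u ℤ.+ x) ℤ.- (u ℤ.+ y))
    lemma′ = ℤ-solve-∀

  fix : ∀ t m w x y → m ℤ.+ m ≡ (w ℤ.+ w) ℤ.+ (x ℤ.- y) →
    (t ℤ.+ m) ℤ.+ (t ℤ.+ m) ≡ (w ℤ.+ w) ℤ.+ ((t ℤ.+ x) ℤ.- (ℤ.- t ℤ.+ y))
  fix t m w x y eq = trans (lemma t m) (trans (cong (λ i → (t ℤ.+ t) ℤ.+ i) eq) (lemma′ t w x y))
    where
    lemma : ∀ t m → (t ℤ.+ m) ℤ.+ (t ℤ.+ m) ≡ (t ℤ.+ t) ℤ.+ (m ℤ.+ m)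
    lemma = ℤ-solve-∀
    lemma′ : ∀ t w x y → (t ℤ.+ t) ℤ.+ ((w ℤ.+ w) ℤ.+ (x ℤ.- y))
      ≡ (w ℤ.+ w) ℤ.+ ((t ℤ.+ x) ℤ.- (ℤ.- t ℤ.+ y))
    lemma′ = ℤ-solve-∀

-- Where z and z′ differ, the sign of z is half the difference of the two signs; where they agree,
-- that difference vanishes and w supplies the sign. Both sides are doubled to avoid halving.
corr-merge : ∀ {s} (z z′ : Vec Bool s) w v →
  corr (merge z z′ w) v ℤ.+ corr (merge z z′ w) v ≡
  (corr w (restrict z z′ v) ℤ.+ corr w (restrict z z′ v)) ℤ.+ (corr z v ℤ.- corr z′ v)
corr-merge []          []           []      []          = refl
corr-merge (true  ∷ z) (true  ∷ z′) (a ∷ w) (c ∷ v)     = keep (sgn (a xor c)) (sgn (not c)) (corr (merge z z′ w) v) (corr w (restrict z z′ v)) (corr z v) (corr z′ v) (corr-merge z z′ w v)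
corr-merge (false ∷ z) (false ∷ z′) (a ∷ w) (c ∷ v)     = keep (sgn (a xor c)) (sgn c) (corr (merge z z′ w) v) (corr w (restrict z z′ v)) (corr z v) (corr z′ v) (corr-merge z z′ w v)
corr-merge (true  ∷ z) (false ∷ z′) w       (true  ∷ v) = fix (sgn false) (corr (merge z z′ w) v) (corr w (restrict z z′ v)) (corr z v) (corr z′ v) (corr-merge z z′ w v)
corr-merge (true  ∷ z) (false ∷ z′) w       (false ∷ v) = fix (sgn true) (corr (merge z z′ w) v) (corr w (restrict z z′ v)) (corr z v) (corr z′ v) (corr-merge z z′ w v)
corr-merge (false ∷ z) (true  ∷ z′) w       (true  ∷ v) = fix (sgn true) (corr (merge z z′ w) v) (corr w (restrict z z′ v)) (corr z v) (corr z′ v) (corr-merge z z′ w v)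
corr-merge (false ∷ z) (true  ∷ z′) w       (false ∷ v) = fix (sgn false) (corr (merge z z′ w) v) (corr w (restrict z z′ v)) (corr z v) (corr z′ v) (corr-merge z z′ w v)

∣i+i∣≡∣i∣+∣i∣ : ∀ i → ∣ i ℤ.+ i ∣ ≡ ∣ i ∣ + ∣ i ∣
∣i+i∣≡∣i∣+∣i∣ (ℤ.+ m)  = refl
∣i+i∣≡∣i∣+∣i∣ -[1+ m ] = cong suc (sym (+-suc m m))

∣corr-merge∣≤ : ∀ {s} (z z′ : Vec Bool s) w v {b} → ∣ corr z v ℤ.- corr z′ v ∣ ≤ b + b →
  ∣ corr (merge z z′ w) v ∣ ≤ ∣ corr w (restrict z z′ v) ∣ + b
∣corr-merge∣≤ z z′ w v {b} close = *-cancelˡ-≤ 2 (begin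
  2 * ∣ m ∣                                      ≡⟨ double ∣ m ∣ ⟩
  ∣ m ∣ + ∣ m ∣                                  ≡⟨ ∣i+i∣≡∣i∣+∣i∣ m ⟨
  ∣ m ℤ.+ m ∣                                    ≡⟨ cong ∣_∣ (corr-merge z z′ w v) ⟩
  ∣ (r ℤ.+ r) ℤ.+ (corr z v ℤ.- corr z′ v) ∣     ≤⟨ ℤ.∣i+j∣≤∣i∣+∣j∣ (r ℤ.+ r) _ ⟩
  ∣ r ℤ.+ r ∣ + ∣ corr z v ℤ.- corr z′ v ∣       ≤⟨ +-mono-≤ (≤-reflexive (∣i+i∣≡∣i∣+∣i∣ r)) close ⟩
  (∣ r ∣ + ∣ r ∣) + (b + b)                      ≡⟨ lemma ∣ r ∣ b ⟩
  2 * (∣ r ∣ + b)                                ∎)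
  where
  open ≤-Reasoning
  m = corr (merge z z′ w) v
  r = corr w (restrict z z′ v)
  double : ∀ n → 2 * n ≡ n + n
  double = solve-∀
  lemma : ∀ n b → (n + n) + (b + b) ≡ 2 * (n + b)
  lemma = solve-∀

∣corr∣≤s : ∀ {s} (z v : Vec Bool s) → ∣ corr z v ∣ ≤ s
∣corr∣≤s []      []      = z≤n
∣corr∣≤s (a ∷ z) (c ∷ v) = ≤-trans (ℤ.∣i+j∣≤∣i∣+∣j∣ (sgn (a xor c)) (corr z v))
  (+-mono-≤ (≤-reflexive (∣sgn∣ (a xor c))) (∣corr∣≤s z v))
  where
  ∣sgn∣ : ∀ a → ∣ sgn a ∣ ≡ 1
  ∣sgn∣ true  = refl
  ∣sgn∣ false = refl

m<[1+m/n]*n : ∀ m n .{{_ : NonZero n}} → m < suc (m div n) * n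
m<[1+m/n]*n m n = subst (_< suc (m div n) * n) (sym (m≡m%n+[m/n]*n m n))
  (+-monoˡ-< (m div n * n) (m%n<n m n))

Balanced : ∀ {s} → List (Vec Bool s) → ℕ → Set
Balanced R D = ∃ λ z → ∀ {v} → v ∈ˡ R → ∣ corr z v ∣ ≤ D

Balanced-mono : ∀ {s} {R : List (Vec Bool s)} {D D′} → D ≤ D′ → Balanced R D → Balanced R D′
Balanced-mono D≤ (z , h) = z , λ v∈ → ≤-trans (h v∈) D≤

trivially-balanced : ∀ {s} (R : List (Vec Bool s)) → Balanced R s
trivially-balanced {s} R = replicate s true , λ {v} _ → ∣corr∣≤s (replicate s true) v

k≤16^k : ∀ k → k ≤ 16 ^ k
k≤16^k zero    = z≤n
k≤16^k (suc k) = begin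
  1 + k                ≤⟨ +-mono-≤ (m^n>0 16 k) (k≤16^k k) ⟩
  16 ^ k + 16 ^ k      ≤⟨ +-monoʳ-≤ (16 ^ k) (m≤m+n (16 ^ k) (14 * 16 ^ k)) ⟩
  16 * 16 ^ k          ∎
  where open ≤-Reasoning

-- With K = k + e and s between 4ᴷ/256ᵏ⁺¹ and 4ᴷ/256ᵏ, the fourth moment allows the
-- label width 8·2ᴷ⁻ᵏ; these widths decay geometrically in k, so that they add up
-- to O(2ᴷ) over all scales.
partial-colouring : ∀ e k {s} (R : List (Vec Bool s)) → length R ≤ 4 ^ (k + e) →
  256 ^ k * s ≤ 4 ^ (k + e) → 4 ^ (k + e) ≤ 256 ^ suc k * s → 8 < s →
  ∃₂ λ z z′ → 16 * agree z z′ ≤ 15 * s ×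
    (∀ {v} → v ∈ˡ R → ∣ corr z v ℤ.- corr z′ v ∣ ≤ 8 * 2 ^ e + 8 * 2 ^ e)
partial-colouring e k {s} R M≤ lower upper 8<s = conclude (far-pair (8 * k + 13) p rows weights size)
  where
  open ≤-Reasoning
  K = k + e
  -- One unit of label sum costs 2 + (8k + 13) bits in `far-pair`. With these `c`, `q` and `p` the
  -- two variable terms of its size condition are at most s/4 each, and 8 < s makes the remaining 2
  -- less than s/4.
  c = 8 * (2 + (8 * k + 13))
  q = s div c
  p = s div 8
  b = 8 * 2 ^ e
  M = length R
  instance
    b≢0 : NonZero b
    b≢0 = m*n≢0 8 (2 ^ e) {{_}} {{m^n≢0 2 e}}
  open PartialColouring R b q
  s≤16p : s ≤ 16 * p
  s≤16p = begin
    s                  ≤⟨ <⇒≤ (m<[1+m/n]*n s 8) ⟩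
    (1 + p) * 8        ≤⟨ *-monoˡ-≤ 8 (+-monoˡ-≤ p 1≤p) ⟩
    (p + p) * 8        ≡⟨ lemma p ⟩
    16 * p             ∎
    where
    lemma : ∀ p → (p + p) * 8 ≡ 16 * p
    lemma = solve-∀
    1≤p : 1 ≤ p
    1≤p = ≰⇒> λ p≤0 → <⇒≱ (m<[1+m/n]*n s 8)
      (≤-trans (*-monoˡ-≤ 8 (s≤s p≤0)) (<⇒≤ 8<s))
  rows : M * 2 ≤ 2 ^ (8 * k + 13) * p
  rows = begin
    M * 2                                ≤⟨ *-monoˡ-≤ 2 (≤-trans M≤ upper) ⟩
    256 ^ suc k * s * 2                  ≤⟨ *-monoˡ-≤ 2 (*-monoʳ-≤ (256 ^ suc k) s≤16p) ⟩
    -- The constant factor 256·16·2 = 2^13 is the origin of the 13.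
    256 ^ suc k * (16 * p) * 2           ≡⟨ lemma 256 (256 ^ k) 16 p 2 ⟩
    256 ^ k * (256 * 16 * 2) * p         ≡⟨ cong (λ t → t * (256 * 16 * 2) * p) (^-*-assoc 2 8 k) ⟩
    2 ^ (8 * k) * 2 ^ 13 * p             ≡⟨ cong (_* p) (^-distribˡ-+-* 2 (8 * k) 13) ⟨
    2 ^ (8 * k + 13) * p                 ∎
    where
    lemma : ∀ a x c p d → a * x * (c * p) * d ≡ x * (a * c * d) * p
    lemma = solve-∀
  -- The width 8·2ᵉ has fourth power 4096·16ᵉ; multiplied by 256ᵏ this exceeds 16ᴷ by the factor
  -- 4096·16ᵏ, which absorbs the linear growth of `c` in k.
  scale : 6 * c ≤ 4096 * 16 ^ k
  scale = begin
    6 * (8 * (2 + (8 * k + 13)))         ≡⟨ cong (λ t → 6 * (8 * t)) (lemma₁ k) ⟩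
    6 * (8 * (15 * 1 + 8 * k))           ≤⟨ *-monoʳ-≤ 6 (*-monoʳ-≤ 8 (+-mono-≤ (*-monoʳ-≤ 15 (m^n>0 16 k)) (*-monoʳ-≤ 8 (k≤16^k k)))) ⟩
    6 * (8 * (15 * 16 ^ k + 8 * 16 ^ k)) ≡⟨ lemma₂ 6 8 15 8 (16 ^ k) ⟩
    6 * 8 * (15 + 8) * 16 ^ k            ≤⟨ *-monoˡ-≤ (16 ^ k) (≤ᵇ⇒≤ 1104 4096 _) ⟩
    4096 * 16 ^ k                        ∎
    where
    lemma₁ : ∀ k → 2 + (8 * k + 13) ≡ 15 * 1 + 8 * k
    lemma₁ = solve-∀
    lemma₂ : ∀ a b c d x → a * (b * (c * x + d * x)) ≡ a * b * (c + d) * x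
    lemma₂ = solve-∀
  b^4 : 4096 * 16 ^ k * 16 ^ K ≡ b ^ 4 * 256 ^ k
  b^4 = begin-equality
    4096 * 16 ^ k * 16 ^ (k + e)           ≡⟨ cong (4096 * 16 ^ k *_) (^-distribˡ-+-* 16 k e) ⟩
    4096 * 16 ^ k * (16 ^ k * 16 ^ e)      ≡⟨ lemma 4096 (16 ^ k) (16 ^ e) ⟩
    4096 * 16 ^ e * (16 ^ k * 16 ^ k)      ≡⟨ cong (4096 * 16 ^ e *_) (^-distribʳ-* 16 16 k) ⟨
    4096 * 16 ^ e * 256 ^ k                ≡⟨ cong (λ t → 4096 * t * 256 ^ k)
                                                (trans (^-*-assoc 2 4 e) (trans (cong (2 ^_) (*-comm 4 e)) (sym (^-*-assoc 2 e 4)))) ⟩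
    8 ^ 4 * (2 ^ e) ^ 4 * 256 ^ k          ≡⟨ cong (_* 256 ^ k) (^-distribʳ-* 8 (2 ^ e) 4) ⟨
    (8 * 2 ^ e) ^ 4 * 256 ^ k              ∎
    where
    lemma : ∀ a x y → a * x * (x * y) ≡ a * y * (x * x)
    lemma = solve-∀
  weights : 6 * M * s ^² ≤ suc q * b ^ 4
  weights = *-cancelʳ-≤ _ _ (256 ^ k) {{m^n≢0 256 k}} (begin
    6 * M * (s * s) * 256 ^ k              ≡⟨ lemma₁ M s (256 ^ k) ⟩
    6 * (M * (256 ^ k * s)) * s            ≤⟨ *-mono-≤ (*-monoʳ-≤ 6 (*-mono-≤ M≤ lower)) (<⇒≤ (m<[1+m/n]*n s c)) ⟩
    6 * (4 ^ K * 4 ^ K) * (suc q * c)      ≡⟨ cong (λ t → 6 * t * (suc q * c)) (^-distribʳ-* 4 4 K) ⟨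
    6 * 16 ^ K * (suc q * c)               ≡⟨ lemma₂ (16 ^ K) (suc q) c ⟩
    suc q * (6 * c * 16 ^ K)               ≤⟨ *-monoʳ-≤ (suc q) (*-monoˡ-≤ (16 ^ K) scale) ⟩
    suc q * (4096 * 16 ^ k * 16 ^ K)       ≡⟨ cong (suc q *_) b^4 ⟩
    suc q * (b ^ 4 * 256 ^ k)              ≡⟨ *-assoc (suc q) (b ^ 4) (256 ^ k) ⟨
    suc q * b ^ 4 * 256 ^ k                ∎)
    where
    lemma₁ : ∀ M s x → 6 * M * (s * s) * x ≡ 6 * (M * (x * s)) * s
    lemma₁ = solve-∀
    lemma₂ : ∀ x q c → 6 * x * (q * c) ≡ q * (6 * c * x)
    lemma₂ = solve-∀
  size : 2 + 2 * ((2 + (8 * k + 13)) * q + p) < s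
  size = *-cancelˡ-< 4 _ _ (begin-strict
    4 * (2 + 2 * ((2 + (8 * k + 13)) * q + p))   ≡⟨ lemma (2 + (8 * k + 13)) q p ⟩
    8 + (q * c + p * 8)                    <⟨ +-mono-<-≤ 8<s (+-mono-≤ (m/n*n≤m s c) (m/n*n≤m s 8)) ⟩
    s + (s + s)                            ≤⟨ m≤m+n _ s ⟩
    s + (s + s) + s                        ≡⟨ lemma′ s ⟩
    4 * s                                  ∎)
    where
    lemma : ∀ t q p → 4 * (2 + 2 * (t * q + p)) ≡ 8 + (q * (8 * t) + p * 8)
    lemma = solve-∀
    lemma′ : ∀ s → s + (s + s) + s ≡ 4 * s
    lemma′ = solve-∀
  conclude : ∃₂ Far → ∃₂ λ z z′ → 16 * agree z z′ ≤ 15 * s ×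
    (∀ {v} → v ∈ˡ R → ∣ corr z v ℤ.- corr z′ v ∣ ≤ b + b)
  conclude (z , z′ , eq , far) = z , z′ , agree≤ , Labels.labels-≡⇒close b R z z′ eq
    where
    agree≤ : 16 * agree z z′ ≤ 15 * s
    agree≤ = +-cancelʳ-≤ s _ _ (begin
      16 * agree z z′ + s                    ≤⟨ +-monoʳ-≤ (16 * agree z z′) (<⇒≤ far) ⟩
      16 * agree z z′ + 16 * dist z z′       ≡⟨ *-distribˡ-+ 16 (agree z z′) (dist z z′) ⟨
      16 * (agree z z′ + dist z z′)          ≡⟨ cong (16 *_) (agree+dist z z′) ⟩
      16 * s                                 ≡⟨ +-comm s (15 * s) ⟩
      15 * s + s                             ∎)

Balanced-merge : ∀ {s} (R : List (Vec Bool s)) z z′ {b D} →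
  (∀ {v} → v ∈ˡ R → ∣ corr z v ℤ.- corr z′ v ∣ ≤ b + b) →
  Balanced (map (restrict z z′) R) D → Balanced R (D + b)
Balanced-merge R z z′ {b} close (w , h) = merge z z′ w , λ {v} v∈ →
  ≤-trans (∣corr-merge∣≤ z z′ w v (close v∈)) (+-monoˡ-≤ b (h (∈-map⁺ (restrict z z′) v∈)))

shrink : ∀ x y s′ s y′ t → 16 * s′ ≤ 15 * s → x * (15 * y * s) ≤ 16 * y′ * t → x * (y * s′) ≤ y′ * t
shrink x y s′ s y′ t s′≤ h = *-cancelˡ-≤ 16 (begin
  16 * (x * (y * s′))      ≡⟨ lemma₁ 16 x y s′ ⟩
  x * (y * (16 * s′))      ≤⟨ *-monoʳ-≤ x (*-monoʳ-≤ y s′≤) ⟩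
  x * (y * (15 * s))       ≡⟨ lemma₂ 15 x y s ⟩
  x * (15 * y * s)         ≤⟨ h ⟩
  16 * y′ * t              ≡⟨ *-assoc 16 y′ t ⟩
  16 * (y′ * t)            ∎)
  where
  open ≤-Reasoning
  lemma₁ : ∀ c x y s → c * (x * (y * s)) ≡ x * (y * (c * s))
  lemma₁ = solve-∀
  lemma₂ : ∀ c x y s → x * (y * (c * s)) ≡ x * (c * y * s)
  lemma₂ = solve-∀

-- 86 partial colourings lead from one scale to the next, since (15/16)⁸⁶ ≤ 1/256.
balance : ∀ e k {s} (R : List (Vec Bool s)) → length R ≤ 4 ^ (k + e) →
  256 ^ k * s ≤ 4 ^ (k + e) → Balanced R (1376 * 2 ^ e)
balance zero k {s} R M≤ s≤ = Balanced-mono (≤-trans s≤1 (s≤s z≤n)) (trivially-balanced R)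
  where
  open ≤-Reasoning
  -- At e = 0 the size bound leaves at most one coordinate, and any sign will do.
  s≤1 : s ≤ 1
  s≤1 = *-cancelˡ-≤ (4 ^ k) {{m^n≢0 4 k}} (begin
    4 ^ k * s          ≤⟨ *-monoˡ-≤ s (^-monoˡ-≤ k (≤ᵇ⇒≤ 4 256 _)) ⟩
    256 ^ k * s        ≤⟨ s≤ ⟩
    4 ^ (k + 0)        ≡⟨ cong (4 ^_) (+-identityʳ k) ⟩
    4 ^ k              ≡⟨ *-identityʳ (4 ^ k) ⟨
    4 ^ k * 1          ∎)
balance (suc e) k {s} R M≤ s≤ = Balanced-mono (≤-reflexive (total (2 ^ e))) (steps 86 R M≤ s≤ s≤₈₆)
  where
  open ≤-Reasoning
  K = k + suc e
  b = 8 * 2 ^ suc e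
  -- Here 1376 = 86·8·2 closes the geometric series: 86 rounds of width 8·2^(e + 1) cost exactly the
  -- 1376·2ᵉ allowed for all later scales.
  total : ∀ x → 1376 * x + 86 * (8 * (2 * x)) ≡ 1376 * (2 * x)
  total x = trans (lemma 1376 86 8 2 x) (*-assoc 1376 2 x)
    where
    lemma : ∀ a b c d x → a * x + b * (c * (d * x)) ≡ (a + b * c * d) * x
    lemma = solve-∀
  s≤₈₆ : 256 ^ suc k * (15 ^ 86 * s) ≤ 16 ^ 86 * 4 ^ K
  s≤₈₆ = begin
    256 * 256 ^ k * (15 ^ 86 * s)      ≡⟨ lemma 256 (256 ^ k) (15 ^ 86) s ⟩
    256 * 15 ^ 86 * (256 ^ k * s)      ≤⟨ *-mono-≤ (≤ᵇ⇒≤ (256 * 15 ^ 86) (16 ^ 86) _) s≤ ⟩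
    16 ^ 86 * 4 ^ K                    ∎
    where
    lemma : ∀ a x y s → a * x * (y * s) ≡ a * y * (x * s)
    lemma = solve-∀
  coarser : ∀ {s} (R : List (Vec Bool s)) → length R ≤ 4 ^ K → 256 ^ suc k * s ≤ 4 ^ K →
    Balanced R (1376 * 2 ^ e)
  coarser {s} R M≤ s≤ = balance e (suc k) R (subst (λ t → length R ≤ 4 ^ t) (+-suc k e) M≤)
    (subst (λ t → 256 ^ suc k * s ≤ 4 ^ t) (+-suc k e) s≤)
  -- The last hypothesis is a countdown: j further shrinkings by 15/16 bring s to the size required
  -- at the next scale.
  steps : ∀ j {s} (R : List (Vec Bool s)) → length R ≤ 4 ^ K → 256 ^ k * s ≤ 4 ^ K →
    256 ^ suc k * (15 ^ j * s) ≤ 16 ^ j * 4 ^ K → Balanced R (1376 * 2 ^ e + j * b)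
  steps zero {s} R M≤ s≤ s≤ⱼ = Balanced-mono (m≤m+n _ _) (coarser R M≤
    (subst₂ (λ t u → 256 ^ suc k * t ≤ u) (*-identityˡ s) (*-identityˡ (4 ^ K)) s≤ⱼ))
  steps (suc j) {s} R M≤ s≤ s≤ⱼ = by-size (s ≤? 8) (256 ^ suc k * s ≤? 4 ^ K)
    where
    D = 1376 * 2 ^ e
    recurse : (∃₂ λ z z′ → 16 * agree z z′ ≤ 15 * s ×
      (∀ {v} → v ∈ˡ R → ∣ corr z v ℤ.- corr z′ v ∣ ≤ b + b)) → Balanced R (D + suc j * b)
    recurse (z , z′ , s′≤ , close) = Balanced-mono
      (≤-reflexive (trans (+-assoc D (j * b) b) (cong (λ t → D + t) (+-comm (j * b) b))))
      (Balanced-merge R z z′ close (steps j (map (restrict z z′) R)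
        (≤-trans (≤-reflexive (length-map (restrict z z′) R)) M≤)
        (≤-trans (*-monoʳ-≤ (256 ^ k) (subst (agree z z′ ≤_) (agree+dist z z′) (m≤m+n _ _))) s≤)
        (shrink (256 ^ suc k) (15 ^ j) (agree z z′) s (16 ^ j) (4 ^ K) s′≤ s≤ⱼ)))
    by-size : Dec (s ≤ 8) → Dec (256 ^ suc k * s ≤ 4 ^ K) → Balanced R (D + suc j * b)
    by-size (yes s≤8) _ = Balanced-mono
      (≤-trans s≤8 (≤-trans (*-mono-≤ {8} {1376} (≤ᵇ⇒≤ 8 1376 _) (m^n>0 2 e)) (m≤m+n D (suc j * b))))
      (trivially-balanced R)
    by-size (no _)    (yes small) = Balanced-mono (m≤m+n D (suc j * b)) (coarser R M≤ small)
    by-size (no s≰8)  (no large)  =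
      recurse (partial-colouring (suc e) k R M≤ s≤ (<⇒≤ (≰⇒> large)) (≰⇒> s≰8))

-- Linear algebra over 𝔽₂

⊕-assoc : ∀ {n} (x y z : 𝔽₂^ n) → (x ⊕ y) ⊕ z ≡ x ⊕ (y ⊕ z)
⊕-assoc = zipWith-assoc xor-assoc

⊕-comm : ∀ {n} (x y : 𝔽₂^ n) → x ⊕ y ≡ y ⊕ x
⊕-comm = zipWith-comm xor-comm

⊕-identityˡ : ∀ {n} (x : 𝔽₂^ n) → 𝟎 ⊕ x ≡ x
⊕-identityˡ = zipWith-identityˡ xor-identityˡ

⊕-identityʳ : ∀ {n} (x : 𝔽₂^ n) → x ⊕ 𝟎 ≡ x
⊕-identityʳ = zipWith-identityʳ xor-identityʳ

⊕-self : ∀ {n} (x : 𝔽₂^ n) → x ⊕ x ≡ 𝟎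
⊕-self []      = refl
⊕-self (a ∷ x) = cong₂ _∷_ (xor-same a) (⊕-self x)

⊕-cancelˡ : ∀ {n} (x y : 𝔽₂^ n) → x ⊕ (x ⊕ y) ≡ y
⊕-cancelˡ x y = trans (sym (⊕-assoc x x y)) (trans (cong (_⊕ y) (⊕-self x)) (⊕-identityˡ y))

false·x≡𝟎 : ∀ {n} (x : 𝔽₂^ n) → false · x ≡ 𝟎
false·x≡𝟎 []      = refl
false·x≡𝟎 (a ∷ x) = cong (false ∷_) (false·x≡𝟎 x)

true·x≡x : ∀ {n} (x : 𝔽₂^ n) → true · x ≡ x
true·x≡x []      = refl
true·x≡x (a ∷ x) = cong (a ∷_) (true·x≡x x)

c·𝟎≡𝟎 : ∀ {n} c → c · 𝟎 {n} ≡ 𝟎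
c·𝟎≡𝟎 {zero}  c = refl
c·𝟎≡𝟎 {suc n} c = cong₂ _∷_ (∧-zeroʳ c) (c·𝟎≡𝟎 {n} c)

⊕-interchange : ∀ {n} (w x y z : 𝔽₂^ n) → (w ⊕ x) ⊕ (y ⊕ z) ≡ (w ⊕ y) ⊕ (x ⊕ z)
⊕-interchange w x y z = begin
  (w ⊕ x) ⊕ (y ⊕ z)   ≡⟨ ⊕-assoc w x (y ⊕ z) ⟩
  w ⊕ (x ⊕ (y ⊕ z))   ≡⟨ cong (w ⊕_) (⊕-assoc x y z) ⟨
  w ⊕ ((x ⊕ y) ⊕ z)   ≡⟨ cong (λ t → w ⊕ (t ⊕ z)) (⊕-comm x y) ⟩
  w ⊕ ((y ⊕ x) ⊕ z)   ≡⟨ cong (w ⊕_) (⊕-assoc y x z) ⟩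
  w ⊕ (y ⊕ (x ⊕ z))   ≡⟨ ⊕-assoc w y (x ⊕ z) ⟨
  (w ⊕ y) ⊕ (x ⊕ z)   ∎
  where open ≡-Reasoning

·-distribʳ-xor : ∀ {n} a b (x : 𝔽₂^ n) → (a xor b) · x ≡ a · x ⊕ b · x
·-distribʳ-xor true true  x = trans (false·x≡𝟎 x) (sym (⊕-self (true · x)))
·-distribʳ-xor true false x = sym (trans (cong (true · x ⊕_) (false·x≡𝟎 x)) (⊕-identityʳ _))
·-distribʳ-xor false b    x = sym (trans (cong (_⊕ b · x) (false·x≡𝟎 x)) (⊕-identityˡ _))

dot : ∀ {n} → 𝔽₂^ n → 𝔽₂^ n → 𝔽₂
dot []      []      = false
dot (a ∷ u) (b ∷ x) = (a ∧ b) xor dot u x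

xor-interchange : ∀ a b c d → (a xor b) xor (c xor d) ≡ (a xor c) xor (b xor d)
xor-interchange false false c     d = refl
xor-interchange false true  false d = refl
xor-interchange false true  true  d = refl
xor-interchange true  false c     d = not-distribˡ-xor c d
xor-interchange true  true  false d = sym (not-involutive d)
xor-interchange true  true  true  d = refl

dot-⊕ : ∀ {n} (u x y : 𝔽₂^ n) → dot u (x ⊕ y) ≡ dot u x xor dot u y
dot-⊕ []      []      []      = refl
dot-⊕ (a ∷ u) (b ∷ x) (c ∷ y) = trans (cong₂ _xor_ (∧-distribˡ-xor a b c) (dot-⊕ u x y))
  (xor-interchange (a ∧ b) (a ∧ c) (dot u x) (dot u y))

dot-· : ∀ {n} (u : 𝔽₂^ n) c x → dot u (c · x) ≡ c ∧ dot u x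
dot-· []      false [] = refl
dot-· []      true  [] = refl
dot-· (a ∷ u) false (b ∷ x) = cong₂ _xor_ (∧-zeroʳ a) (dot-· u false x)
dot-· (a ∷ u) true  (b ∷ x) = cong ((a ∧ b) xor_) (dot-· u true x)

dot-𝟎ʳ : ∀ {n} (u : 𝔽₂^ n) → dot u 𝟎 ≡ false
dot-𝟎ʳ []      = refl
dot-𝟎ʳ (a ∷ u) = cong₂ _xor_ (∧-zeroʳ a) (dot-𝟎ʳ u)

dot-𝟎ˡ : ∀ {n} (x : 𝔽₂^ n) → dot 𝟎 x ≡ false
dot-𝟎ˡ []      = refl
dot-𝟎ˡ (b ∷ x) = dot-𝟎ˡ x

⨁ : ∀ {I : Set} {n} → (I → 𝔽₂^ n) → List I → 𝔽₂^ n
⨁ g = foldr (λ i → g i ⊕_) 𝟎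

-- The quotient map by the pivot `true ∷ w` in coordinates: its kernel consists of zero and the
-- pivot.
eliminate : ∀ {n} → 𝔽₂^ n → 𝔽₂^ (suc n) → 𝔽₂^ n
eliminate w (a ∷ v) = v ⊕ a · w

eliminate-⨁ : ∀ {I : Set} {n} (w : 𝔽₂^ n) (g : I → 𝔽₂^ (suc n)) js →
  eliminate w (⨁ g js) ≡ ⨁ (eliminate w ∘ g) js
eliminate-⨁ w g [] = trans (cong (𝟎 ⊕_) (false·x≡𝟎 w)) (⊕-identityˡ 𝟎)
eliminate-⨁ w g (j ∷ js) with g j | ⨁ g js | eliminate-⨁ w g js
... | a ∷ v | b ∷ t | eq = begin
  (v ⊕ t) ⊕ (a xor b) · w        ≡⟨ cong ((v ⊕ t) ⊕_) (·-distribʳ-xor a b w) ⟩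
  (v ⊕ t) ⊕ (a · w ⊕ b · w)      ≡⟨ ⊕-interchange v t (a · w) (b · w) ⟩
  (v ⊕ a · w) ⊕ (t ⊕ b · w)      ≡⟨ cong ((v ⊕ a · w) ⊕_) eq ⟩
  (v ⊕ a · w) ⊕ _                ∎
  where open ≡-Reasoning

-- A functional on the quotient pulls back to one vanishing on the pivot, which determines the new
-- first coordinate.
dot-eliminate : ∀ {n} (u w : 𝔽₂^ n) x → dot (dot u w ∷ u) x ≡ dot u (eliminate w x)
dot-eliminate u w (a ∷ v) = begin
  (dot u w ∧ a) xor dot u v      ≡⟨ xor-comm (dot u w ∧ a) (dot u v) ⟩
  dot u v xor (dot u w ∧ a)      ≡⟨ cong (dot u v xor_) (∧-comm (dot u w) a) ⟩
  dot u v xor (a ∧ dot u w)      ≡⟨ cong (dot u v xor_) (dot-· u a w) ⟨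
  dot u v xor dot u (a · w)      ≡⟨ dot-⊕ u v (a · w) ⟨
  dot u (v ⊕ a · w)              ∎
  where open ≡-Reasoning

-- The fibres are cosets of the kernel, so an equation modulo the pivot becomes exact after adding
-- the pivot at most once.
eliminate-≡ : ∀ {n} (w : 𝔽₂^ n) x y → eliminate w x ≡ eliminate w y →
  x ≡ y ⊎ (true ∷ w) ⊕ x ≡ y
eliminate-≡ w (true  ∷ x) (true  ∷ y) eq = inj₁ (cong (true ∷_) (begin
  x                  ≡⟨ add² x ⟩
  w ⊕ (x ⊕ true · w) ≡⟨ cong (w ⊕_) eq ⟩
  w ⊕ (y ⊕ true · w) ≡⟨ add² y ⟨
  y                  ∎))
  where
  open ≡-Reasoning
  add² : ∀ x → x ≡ w ⊕ (x ⊕ true · w)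
  add² x = sym (trans (cong (λ t → w ⊕ (x ⊕ t)) (true·x≡x w)) (trans (cong (w ⊕_) (⊕-comm x w)) (⊕-cancelˡ w x)))
eliminate-≡ w (false ∷ x) (false ∷ y) eq = inj₁ (cong (false ∷_) (trans (sym (drop x)) (trans eq (drop y))))
  where
  drop : ∀ x → x ⊕ false · w ≡ x
  drop x = trans (cong (x ⊕_) (false·x≡𝟎 w)) (⊕-identityʳ x)
eliminate-≡ w (true  ∷ x) (false ∷ y) eq = inj₂ (cong (false ∷_) (begin
  w ⊕ x              ≡⟨ ⊕-comm w x ⟩
  x ⊕ w              ≡⟨ cong (x ⊕_) (true·x≡x w) ⟨
  x ⊕ true · w       ≡⟨ eq ⟩
  y ⊕ false · w      ≡⟨ cong (y ⊕_) (false·x≡𝟎 w) ⟩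
  y ⊕ 𝟎              ≡⟨ ⊕-identityʳ y ⟩
  y                  ∎))
  where open ≡-Reasoning
eliminate-≡ w (false ∷ x) (true  ∷ y) eq = inj₂ (cong (true ∷_) (begin
  w ⊕ x                ≡⟨ cong (w ⊕_) (⊕-identityʳ x) ⟨
  w ⊕ (x ⊕ 𝟎)          ≡⟨ cong (λ t → w ⊕ (x ⊕ t)) (false·x≡𝟎 w) ⟨
  w ⊕ (x ⊕ false · w)  ≡⟨ cong (w ⊕_) eq ⟩
  w ⊕ (y ⊕ true · w)   ≡⟨ cong (λ t → w ⊕ (y ⊕ t)) (true·x≡x w) ⟩
  w ⊕ (y ⊕ w)          ≡⟨ cong (w ⊕_) (⊕-comm y w) ⟩
  w ⊕ (w ⊕ y)          ≡⟨ ⊕-cancelˡ w y ⟩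
  y                    ∎))
  where open ≡-Reasoning

⨁-false : ∀ {I : Set} {X : Pred I 0ℓ} {n} (g : I → 𝔽₂^ (suc n)) → (∀ {x} → X x → head (g x) ≡ false) →
  ∀ {js} → All X js → ⨁ g js ≡ false ∷ ⨁ (tail ∘ g) js
⨁-false g h []                = refl
⨁-false g h {j ∷ _} (p ∷ ps) with g j | h p | ⨁-false g h ps
... | .false ∷ v | refl | eq = cong ((false ∷ v) ⊕_) eq

Spanned : ∀ {I : Set} {n} → Pred I 0ℓ → (I → 𝔽₂^ n) → 𝔽₂^ n → Set
Spanned {n = n} X g e = ∃ λ js → All X js × length js ≤ n × ⨁ g js ≡ e

Separated : ∀ {I : Set} {n} → Pred I 0ℓ → (I → 𝔽₂^ n) → 𝔽₂^ n → Set
Separated X g e = ∃ λ u → (∀ {x} → X x → dot u (g x) ≡ false) × dot u e ≡ true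

-- Gaussian elimination. A vector with leading `true` serves as pivot, and the problem passes to the
-- quotient. If there is none, either e has leading `true` and the first coordinate separates, or
-- the first coordinate is dropped. Each dimension adds at most one vector to the list.
span-or-separate : ∀ {m n} {X : Pred (𝔽₂^ m) 0ℓ} → Decidable X →
  ∀ (g : 𝔽₂^ m → 𝔽₂^ n) e → Spanned X g e ⊎ Separated X g e
span-or-separate {n = zero}  X? g [] = inj₁ ([] , [] , z≤n , refl)
span-or-separate {n = suc n} X? g e with any? (λ x → X? x ×-dec (head (g x) ≟ᵇ true))
... | yes (x₀ , X₀ , h₀) with g x₀ in g₀
span-or-separate {n = suc n} X? g e | yes (x₀ , X₀ , refl) | .true ∷ w
  with span-or-separate X? (eliminate w ∘ g) (eliminate w e)
...   | inj₂ (u , zero-on-X , one-on-e) = inj₂ (dot u w ∷ u ,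
          (λ {x} p → trans (dot-eliminate u w (g x)) (zero-on-X p)) ,
          trans (dot-eliminate u w e) one-on-e)
...   | inj₁ (js , Xjs , len , eq) with eliminate-≡ w (⨁ g js) e (trans (eliminate-⨁ w g js) eq)
...     | inj₁ eq′ = inj₁ (js , Xjs , m≤n⇒m≤1+n len , eq′)
...     | inj₂ eq′ = inj₁ (x₀ ∷ js , X₀ ∷ Xjs , s≤s len , trans (cong (_⊕ ⨁ g js) g₀) eq′)
span-or-separate {n = suc n} {X} X? g (true  ∷ e) | no none = inj₂ (true ∷ 𝟎 , zero-on-X , cong not (dot-𝟎ˡ e))
  where
  zero-on-X : ∀ {x} → X x → dot (true ∷ 𝟎) (g x) ≡ false
  zero-on-X {x} p with g x | (λ h → none (x , p , h))
  ... | true  ∷ v | ¬h = contradiction refl ¬h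
  ... | false ∷ v | _  = dot-𝟎ˡ v
span-or-separate {n = suc n} {X} X? g (false ∷ e) | no none with span-or-separate X? (tail ∘ g) e
... | inj₁ (js , Xjs , len , eq) = inj₁ (js , Xjs , m≤n⇒m≤1+n len ,
        trans (⨁-false g (λ {x} p → ¬-not (λ h → none (x , p , h))) Xjs) (cong (false ∷_) eq))
... | inj₂ (u , zero-on-X , one-on-e) = inj₂ (false ∷ u , zero-on-X′ , one-on-e)
  where
  zero-on-X′ : ∀ {x} → X x → dot (false ∷ u) (g x) ≡ false
  zero-on-X′ {x} p with g x | zero-on-X p
  ... | _ ∷ v | h = h

odd : ℕ → Bool
odd zero    = false
odd (suc n) = not (odd n)

OddRelation : ∀ {n} → Pred (𝔽₂^ n) 0ℓ → Set
OddRelation {n} X = ∃ λ js → All X js × length js ≤ suc n × odd (length js) ≡ true × ⨁ id js ≡ 𝟎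

-- The extra coordinate `true` records the parity of the list, so reaching `true ∷ 𝟎` is an odd
-- relation. A functional separating `true ∷ 𝟎` has leading `true`, and its vanishing on `true ∷ x`
-- says that `dot u x` is `true`.
odd-relation-or-hyperplane : ∀ {n} {X : Pred (𝔽₂^ n) 0ℓ} → Decidable X →
  OddRelation X ⊎ ∃ λ u → ∀ {x} → X x → dot u x ≡ true
odd-relation-or-hyperplane X? with span-or-separate X? (true ∷_) (true ∷ 𝟎)
... | inj₁ (js , Xjs , len , eq) with ∷-injective (trans (sym (⨁-lift js)) eq)
  where
  ⨁-lift : ∀ {n} (js : List (𝔽₂^ n)) → ⨁ (true ∷_) js ≡ odd (length js) ∷ ⨁ id js
  ⨁-lift []       = refl
  ⨁-lift (j ∷ js) rewrite ⨁-lift js = refl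
...   | isOdd , sum0 = inj₁ (js , Xjs , len , isOdd , sum0)
odd-relation-or-hyperplane X? | inj₂ (false ∷ u , _ , one) = contradiction (trans (sym (dot-𝟎ʳ u)) one) λ ()
odd-relation-or-hyperplane X? | inj₂ (true ∷ u , zero-on-X , _) = inj₂ (u , λ {x} p → flip (dot u x) (zero-on-X p))
  where
  flip : ∀ b → not b ≡ false → b ≡ true
  flip true _ = refl

-- Bases of hyperplanes.

linearCombination-map : ∀ {m n d} (f : 𝔽₂^ m → 𝔽₂^ n) → f 𝟎 ≡ 𝟎 →
  (∀ x y → f (x ⊕ y) ≡ f x ⊕ f y) → (∀ c x → f (c · x) ≡ c · f x) →
  ∀ (c : Vec 𝔽₂ d) b → linearCombination c (Vec.map f b) ≡ f (linearCombination c b)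
linearCombination-map f f𝟎 f⊕ f· []      []      = sym f𝟎
linearCombination-map f f𝟎 f⊕ f· (c ∷ cs) (v ∷ b) = sym (trans (f⊕ (c · v) (linearCombination cs b))
  (cong₂ _⊕_ (f· c v) (sym (linearCombination-map f f𝟎 f⊕ f· cs b))))

insert-false : ∀ {n} → 𝔽₂^ (suc n) → 𝔽₂^ (suc (suc n))
insert-false (a ∷ x) = a ∷ false ∷ x

-- The orthogonal complement of `true ∷ u` is the graph of `dot u`; this is the image of the
-- standard basis under x ↦ `dot u x ∷ x`.
graph-basis : ∀ {d} → 𝔽₂^ d → Vec (𝔽₂^ (suc d)) d
graph-basis []      = []
graph-basis (a ∷ u) = (a ∷ true ∷ 𝟎) ∷ Vec.map insert-false (graph-basis u)

linearCombination-graph-basis : ∀ {d} (u c : 𝔽₂^ d) → linearCombination c (graph-basis u) ≡ dot u c ∷ c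
linearCombination-graph-basis []      []      = refl
linearCombination-graph-basis (a ∷ u) (c ∷ cs) = begin
  (c ∧ a ∷ c ∧ true ∷ c · 𝟎) ⊕ linearCombination cs (Vec.map insert-false (graph-basis u))
    ≡⟨ cong ((c ∧ a ∷ c ∧ true ∷ c · 𝟎) ⊕_) (linearCombination-map insert-false refl
         (λ { (_ ∷ _) (_ ∷ _) → refl }) (λ { c (a ∷ x) → cong (λ t → c ∧ a ∷ t ∷ c · x) (sym (∧-zeroʳ c)) })
         cs (graph-basis u)) ⟩
  (c ∧ a ∷ c ∧ true ∷ c · 𝟎) ⊕ insert-false (linearCombination cs (graph-basis u))
    ≡⟨ cong (λ t → (c ∧ a ∷ c ∧ true ∷ c · 𝟎) ⊕ insert-false t) (linearCombination-graph-basis u cs) ⟩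
  ((c ∧ a) xor dot u cs) ∷ ((c ∧ true) xor false) ∷ (c · 𝟎 ⊕ cs)
    ≡⟨ cong₂ _∷_ (cong (_xor dot u cs) (∧-comm c a))
         (cong₂ _∷_ (trans (xor-identityʳ (c ∧ true)) (∧-identityʳ c))
                    (trans (cong (_⊕ cs) (c·𝟎≡𝟎 c)) (⊕-identityˡ cs))) ⟩
  ((a ∧ c) xor dot u cs) ∷ c ∷ cs ∎
  where open ≡-Reasoning

infix 8 _ᗮ

_ᗮ : ∀ {n} → 𝔽₂^ n → Pred (𝔽₂^ n) 0ℓ
(u ᗮ) x = dot u x ≡ false

graph-basis-members : ∀ {d} (u : 𝔽₂^ d) → VecAll.All ((true ∷ u) ᗮ) (graph-basis u)
graph-basis-members []      = VecAll.[]
graph-basis-members (a ∷ u) = first VecAll.∷ VecAll.map⁺ (VecAll.map (λ {x} → lift x) (graph-basis-members u))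
  where
  first : dot (true ∷ a ∷ u) (a ∷ true ∷ 𝟎) ≡ false
  first = trans (cong (a xor_) (trans (cong₂ _xor_ (∧-identityʳ a) (dot-𝟎ʳ u)) (xor-identityʳ a))) (xor-same a)
  lift : ∀ x → x ∈ (true ∷ u) ᗮ → dot (true ∷ a ∷ u) (insert-false x) ≡ false
  lift (b ∷ x) h = trans (cong (λ t → b xor (t xor dot u x)) (∧-zeroʳ a)) h

xor≡false⇒≡ : ∀ a b → a xor b ≡ false → b ≡ a
xor≡false⇒≡ true  true  _ = refl
xor≡false⇒≡ false false _ = refl

-- A leading `true` makes the hyperplane a graph. A leading `false` leaves the first coordinate
-- free, so the first unit vector is adjoined to a basis from one dimension lower.
hyperplane-dimension : ∀ {d} (u : 𝔽₂^ (suc d)) → u ≢ 𝟎 → HasDimension (u ᗮ) d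
hyperplane-dimension (true ∷ u) _ = graph-basis u , record
  { members     = graph-basis-members u
  ; independent = λ c eq → proj₂ (∷-injective (trans (sym (linearCombination-graph-basis u c)) eq))
  ; spanning    = λ { {a ∷ x} h → x , trans (linearCombination-graph-basis u x)
                                            (cong (_∷ x) (xor≡false⇒≡ a (dot u x) h)) }
  }
hyperplane-dimension {zero}  (false ∷ []) u≢𝟎 = contradiction refl u≢𝟎
hyperplane-dimension {suc d} (false ∷ u)  u≢𝟎
  with hyperplane-dimension u (λ u≡𝟎 → u≢𝟎 (cong (false ∷_) u≡𝟎))
... | b , isBasis = (true ∷ 𝟎) ∷ Vec.map (false ∷_) b , record
  { members     = dot-𝟎ʳ u VecAll.∷ VecAll.map⁺ members
  ; independent = λ { (c ∷ cs) eq → let (c≡ , cs≡) = ∷-injective (trans (sym (combine c cs)) eq)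
                                    in cong₂ _∷_ c≡ (independent cs cs≡) }
  ; spanning    = λ { {a ∷ x} h → let (cs , eq) = spanning h
                                  in a ∷ cs , trans (combine a cs) (cong (a ∷_) eq) }
  }
  where
  open IsBasis isBasis
  combine : ∀ c cs → linearCombination (c ∷ cs) ((true ∷ 𝟎) ∷ Vec.map (false ∷_) b) ≡ c ∷ linearCombination cs b
  combine c cs = begin
    (c ∧ true ∷ c · 𝟎) ⊕ linearCombination cs (Vec.map (false ∷_) b)
      ≡⟨ cong₂ (λ s t → (c ∧ true ∷ s) ⊕ t) (c·𝟎≡𝟎 c)
           (linearCombination-map (false ∷_) refl (λ _ _ → refl)
             (λ c x → cong (_∷ c · x) (sym (∧-zeroʳ c))) cs b) ⟩
    ((c ∧ true) xor false) ∷ 𝟎 ⊕ linearCombination cs b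
      ≡⟨ cong₂ _∷_ (trans (xor-identityʳ (c ∧ true)) (∧-identityʳ c)) (⊕-identityˡ _) ⟩
    c ∷ linearCombination cs b ∎
    where open ≡-Reasoning

hyperplane-isCoset : ∀ {n} (u : 𝔽₂^ n) → 1 ≤ n → u ≢ 𝟎 → IsCosetOfCodimension 1 (u ᗮ)
hyperplane-isCoset {suc d} u _ u≢𝟎 = record
  { v          = 𝟎
  ; V          = u ᗮ
  ; isSubspace = record
    { 𝟎-closed = dot-𝟎ʳ u
    ; ⊕-closed = λ {x} {y} p q → trans (dot-⊕ u x y) (cong₂ _xor_ p q)
    ; ·-closed = λ c {x} p → trans (dot-· u c x) (trans (cong (c ∧_) p) (∧-zeroʳ c))
    }
  ; d          = d
  ; d+k≡n      = +-comm d 1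
  ; dimension  = hyperplane-dimension u u≢𝟎
  ; isCoset    = (λ {x} p → x , p , sym (⊕-identityˡ x)) ,
                 (λ { (w , p , refl) → trans (cong (dot u) (⊕-identityˡ w)) p })
  }

-- Non-differences and alternating walks.

Difference : ∀ {n} → Pred (𝔽₂^ n) 0ℓ → Pred (𝔽₂^ n) 0ℓ
Difference A x = ∃ λ a → A a × A (a ⊕ x)

Difference? : ∀ {n} {A : Pred (𝔽₂^ n) 0ℓ} → Decidable A → Decidable (Difference A)
Difference? A? x = any? λ a → A? a ×-dec A? (a ⊕ x)

Difference⊆⊞ : ∀ {n} {A : Pred (𝔽₂^ n) 0ℓ} → Difference A ⊆ A ⊞ A
Difference⊆⊞ {x = x} (a , p , q) = a , a ⊕ x , p , q , sym (⊕-cancelˡ a x)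

-- If `dot u` is `true` on all non-differences, a vector orthogonal to u cannot be a non-difference,
-- and by decidability it is a difference.
odd-relation-or-coset : ∀ {n} {A : Pred (𝔽₂^ n) 0ℓ} → 1 ≤ n → Decidable A →
  OddRelation (λ x → ¬ Difference A x) ⊎ ContainsCosetOfCodimension 1 (A ⊞ A)
odd-relation-or-coset {suc n} {A} 1≤n A? with odd-relation-or-hyperplane (λ x → ¬? (Difference? A? x))
... | inj₁ rel = inj₁ rel
... | inj₂ (u , one) with ≡-dec _≟ᵇ_ u 𝟎
...   | no u≢𝟎 = inj₂ (u ᗮ , hyperplane-isCoset u 1≤n u≢𝟎 , λ {x} h → Difference⊆⊞
          (decidable-stable (Difference? A? x) λ ¬p → contradiction (trans (sym h) (one ¬p)) λ ()))
-- For u = 𝟎 there are no non-differences at all, and any hyperplane serves.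
...   | yes refl = inj₂ ((true ∷ 𝟎) ᗮ , hyperplane-isCoset (true ∷ 𝟎) 1≤n (λ ()) , λ {x} _ → Difference⊆⊞
          (decidable-stable (Difference? A? x) λ ¬p → contradiction (trans (sym (dot-𝟎ˡ x)) (one ¬p)) λ ()))

-- Points are recorded relative to the start z, so that the list is fixed before balancing chooses
-- z.
visited : ∀ {n} → 𝔽₂^ n → 𝔽₂^ n → List (𝔽₂^ n) → List (𝔽₂^ n)
visited y p []       = p ∷ []
visited y p (x ∷ xs) = p ∷ (p ⊕ x) ∷ visited y (p ⊕ (x ⊕ y)) xs

start∈visited : ∀ {n} (y p : 𝔽₂^ n) xs → p ∈ˡ visited y p xs
start∈visited y p []      = here refl
start∈visited y p (_ ∷ _) = here refl

length-visited : ∀ {n} (y p : 𝔽₂^ n) xs → length (visited y p xs) ≡ 1 + length xs * 2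
length-visited y p []       = refl
length-visited y p (x ∷ xs) = cong (2 +_) (length-visited y (p ⊕ (x ⊕ y)) xs)

⨁-⊕ : ∀ {n} (y : 𝔽₂^ n) xs → ⨁ (_⊕ y) xs ≡ ⨁ id xs ⊕ odd (length xs) · y
⨁-⊕ y []       = sym (trans (cong (𝟎 ⊕_) (false·x≡𝟎 y)) (⊕-identityˡ 𝟎))
⨁-⊕ y (x ∷ xs) = begin
  (x ⊕ y) ⊕ ⨁ (_⊕ y) xs                              ≡⟨ cong ((x ⊕ y) ⊕_) (⨁-⊕ y xs) ⟩
  (x ⊕ y) ⊕ (⨁ id xs ⊕ odd (length xs) · y)          ≡⟨ ⊕-interchange x y _ _ ⟩
  (x ⊕ ⨁ id xs) ⊕ (y ⊕ odd (length xs) · y)          ≡⟨ cong (λ t → (x ⊕ ⨁ id xs) ⊕ (t ⊕ odd (length xs) · y)) (true·x≡x y) ⟨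
  (x ⊕ ⨁ id xs) ⊕ (true · y ⊕ odd (length xs) · y)   ≡⟨ cong ((x ⊕ ⨁ id xs) ⊕_) (·-distribʳ-xor true (odd (length xs)) y) ⟨
  (x ⊕ ⨁ id xs) ⊕ not (odd (length xs)) · y          ∎
  where open ≡-Reasoning

-- A step by a non-difference of A leaves A, hence enters B; the next step, by a
-- non-difference of B, returns to A.
alternating-walk : ∀ {n} {A B : Pred (𝔽₂^ n) 0ℓ} z y → ¬ Difference B y →
  ∀ p xs → All (λ x → ¬ Difference A x) xs →
  (∀ {v} → v ∈ˡ visited y p xs → A (z ⊕ v) ⊎ B (z ⊕ v)) →
  A (z ⊕ p) → A (z ⊕ (p ⊕ ⨁ (_⊕ y) xs))
alternating-walk {A = A} z y ¬By p [] [] cover a = subst (λ t → A (z ⊕ t)) (sym (⊕-identityʳ p)) a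
alternating-walk {A = A} {B} z y ¬By p (x ∷ xs) (¬Ax ∷ ¬Axs) cover a =
  subst (λ t → A (z ⊕ t)) (⊕-assoc p (x ⊕ y) (⨁ (_⊕ y) xs))
    (alternating-walk z y ¬By p′ xs ¬Axs (cover ∘ there ∘ there) a′)
  where
  p′ = p ⊕ (x ⊕ y)
  b : B (z ⊕ (p ⊕ x))
  b with cover (there (here refl))
  ... | inj₁ a₁ = contradiction (z ⊕ p , a , subst A (sym (⊕-assoc z p x)) a₁) ¬Ax
  ... | inj₂ b₁ = b₁
  a′ : A (z ⊕ p′)
  a′ with cover (there (there (start∈visited y p′ xs)))
  ... | inj₁ a₁ = a₁
  ... | inj₂ b₁ = contradiction (z ⊕ (p ⊕ x) , b , subst B
          (trans (cong (z ⊕_) (sym (⊕-assoc p x y))) (sym (⊕-assoc z (p ⊕ x) y))) b₁) ¬By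

-- The tail `xs` has even length, so the steps by y cancel and the walk ends at z plus the sum of
-- `xs`, which is z ⊕ x. Then z and z ⊕ x both lie in A, although x is a non-difference.
no-odd-closed-walk : ∀ {n} {A B : Pred (𝔽₂^ n) 0ℓ} z y → ¬ Difference B y →
  ∀ x xs → All (λ x → ¬ Difference A x) (x ∷ xs) → odd (length (x ∷ xs)) ≡ true → ⨁ id (x ∷ xs) ≡ 𝟎 →
  (∀ {v} → v ∈ˡ visited y 𝟎 xs → A (z ⊕ v) ⊎ B (z ⊕ v)) → ¬ A z
no-odd-closed-walk {A = A} z y ¬By x xs (¬Ax ∷ ¬Axs) isOdd sum0 cover a = ¬Ax (z , a , subst (λ t → A (z ⊕ t)) end
  (alternating-walk z y ¬By 𝟎 xs ¬Axs cover (subst A (sym (⊕-identityʳ z)) a)))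
  where
  open ≡-Reasoning
  end : 𝟎 ⊕ ⨁ (_⊕ y) xs ≡ x
  end = begin
    𝟎 ⊕ ⨁ (_⊕ y) xs                        ≡⟨ ⊕-identityˡ _ ⟩
    ⨁ (_⊕ y) xs                            ≡⟨ ⨁-⊕ y xs ⟩
    ⨁ id xs ⊕ odd (length xs) · y          ≡⟨ cong (λ c → ⨁ id xs ⊕ c · y) (trans (sym (not-involutive _)) (cong not isOdd)) ⟩
    ⨁ id xs ⊕ false · y                    ≡⟨ cong (⨁ id xs ⊕_) (false·x≡𝟎 y) ⟩
    ⨁ id xs ⊕ 𝟎                            ≡⟨ ⊕-identityʳ _ ⟩
    ⨁ id xs                                ≡⟨ ⊕-cancelˡ x (⨁ id xs) ⟨
    x ⊕ (x ⊕ ⨁ id xs)                      ≡⟨ cong (x ⊕_) sum0 ⟩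
    x ⊕ 𝟎                                  ≡⟨ ⊕-identityʳ x ⟩
    x                                      ∎

-- Weights along the walks.

corr+2*dist : ∀ {n} (z v : 𝔽₂^ n) → corr z v ℤ.+ ℤ.+ (2 * dist z v) ≡ ℤ.+ n
corr+2*dist []      []      = refl
corr+2*dist {suc n} (a ∷ z) (c ∷ v) with a xor c
... | false = trans (ℤ.+-assoc ℤ.1ℤ (corr z v) _) (cong (λ t → ℤ.1ℤ ℤ.+ t) (corr+2*dist z v))
... | true  = begin
  (ℤ.-1ℤ ℤ.+ corr z v) ℤ.+ ℤ.+ (2 * suc (dist z v))
    ≡⟨ cong (λ t → (ℤ.-1ℤ ℤ.+ corr z v) ℤ.+ ℤ.+ t) (*-suc 2 (dist z v)) ⟩
  (ℤ.-1ℤ ℤ.+ corr z v) ℤ.+ (ℤ.+ 2 ℤ.+ ℤ.+ (2 * dist z v))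
    ≡⟨ lemma (corr z v) (ℤ.+ (2 * dist z v)) ⟩
  ℤ.1ℤ ℤ.+ (corr z v ℤ.+ ℤ.+ (2 * dist z v))
    ≡⟨ cong (λ t → ℤ.1ℤ ℤ.+ t) (corr+2*dist z v) ⟩
  ℤ.+ suc n ∎
  where
  open ≡-Reasoning
  lemma : ∀ x y → (ℤ.-1ℤ ℤ.+ x) ℤ.+ (ℤ.+ 2 ℤ.+ y) ≡ ℤ.1ℤ ℤ.+ (x ℤ.+ y)
  lemma = ℤ-solve-∀

-- As `dist z v` is the weight of z ⊕ v, a small correlation keeps that weight from falling far
-- below n/2.
n≤∣corr∣+2*dist : ∀ {n} (z v : 𝔽₂^ n) → n ≤ ∣ corr z v ∣ + 2 * dist z v
n≤∣corr∣+2*dist z v = subst (_≤ ∣ corr z v ∣ + 2 * dist z v) (cong ∣_∣ (corr+2*dist z v))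
  (ℤ.∣i+j∣≤∣i∣+∣j∣ (corr z v) (ℤ.+ (2 * dist z v)))

two-class-cover : ∀ {n} K → 1 ≤ n → 4 * n + 2 ≤ 4 ^ K →
  {A B : Pred (𝔽₂^ n) 0ℓ} → Decidable A → Decidable B →
  (∀ x → n ≤ 1376 * 2 ^ K + 2 * weight x → A x ⊎ B x) →
  ContainsCosetOfCodimension 1 (A ⊞ A) ⊎ ContainsCosetOfCodimension 1 (B ⊞ B)
two-class-cover {n} K 1≤n n≤ {A} {B} A? B? cover
  with odd-relation-or-coset 1≤n A? | odd-relation-or-coset 1≤n B?
... | inj₂ c | _      = inj₁ c
... | inj₁ _ | inj₂ c = inj₂ c
-- Odd length makes both relations nonempty. The head of each closes its own walk and is also the
-- fixed non-difference used in the other.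
... | inj₁ (x ∷ xs , ¬A@(¬Ax ∷ _) , s≤s lenx , oddx , sumx) | inj₁ (y ∷ ys , ¬B@(¬By ∷ _) , s≤s leny , oddy , sumy) =
  ⊥-elim (colour (balance K 0 R R≤ (≤-trans (≤-reflexive (*-identityˡ n)) n≤4^K)))
  where
  open ≤-Reasoning
  P = visited y 𝟎 xs
  Q = visited x 𝟎 ys
  R = P ++ Q
  R≤ : length R ≤ 4 ^ K
  R≤ = begin
    length (P ++ Q)                                ≡⟨ length-++ P ⟩
    length P + length Q                            ≡⟨ cong₂ _+_ (length-visited y 𝟎 xs) (length-visited x 𝟎 ys) ⟩
    (1 + length xs * 2) + (1 + length ys * 2)      ≤⟨ +-mono-≤ (s≤s (*-monoˡ-≤ 2 lenx)) (s≤s (*-monoˡ-≤ 2 leny)) ⟩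
    (1 + n * 2) + (1 + n * 2)                      ≡⟨ lemma n ⟩
    4 * n + 2                                      ≤⟨ n≤ ⟩
    4 ^ K                                          ∎
    where
    lemma : ∀ n → (1 + n * 2) + (1 + n * 2) ≡ 4 * n + 2
    lemma = solve-∀
  n≤4^K : n ≤ 4 ^ K
  n≤4^K = ≤-trans (≤-trans (m≤m+n n (3 * n)) (m≤m+n (4 * n) 2)) n≤
  colour : Balanced R (1376 * 2 ^ K) → ⊥
  -- Both walks start at 𝟎, so z itself is covered by A or B.
  colour (z , balanced) = excluded (high (∈-++⁺ˡ (start∈visited y 𝟎 xs)))
    where
    high : ∀ {v} → v ∈ˡ R → A (z ⊕ v) ⊎ B (z ⊕ v)
    high {v} v∈ = cover (z ⊕ v) (≤-trans (n≤∣corr∣+2*dist z v) (+-monoˡ-≤ _ (balanced v∈)))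
    excluded : ¬ (A (z ⊕ 𝟎) ⊎ B (z ⊕ 𝟎))
    excluded (inj₁ a) = no-odd-closed-walk z y ¬By x xs ¬A oddx sumx (high ∘ ∈-++⁺ˡ) (subst A (⊕-identityʳ z) a)
    excluded (inj₂ b) = no-odd-closed-walk z x ¬Ax y ys ¬B oddy sumy (Sum.swap ∘ high ∘ ∈-++⁺ʳ P)
      (subst B (⊕-identityʳ z) b)

-- Square roots and real radii

⌊√⌋-scale : ∀ n q → ⌊√ n ⌋ * q ≤ ⌊√ n * (q * q) ⌋
⌊√⌋-scale n q = ≮⇒≥ λ lt → <-irrefl refl (begin-strict
  n * (q * q)                  <⟨ ⌊√⌋-upper (n * (q * q)) ⟩
  suc S * suc S                ≤⟨ *-mono-≤ lt lt ⟩
  σ * q * (σ * q)              ≡⟨ lemma σ q ⟩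
  σ * σ * (q * q)              ≤⟨ *-monoˡ-≤ (q * q) (⌊√⌋-lower n) ⟩
  n * (q * q)                  ∎)
  where
  open ≤-Reasoning
  σ = ⌊√ n ⌋
  S = ⌊√ n * (q * q) ⌋
  lemma : ∀ a b → a * b * (a * b) ≡ a * a * (b * b)
  lemma = solve-∀

⌊√⌋-pos : ∀ {n} → 1 ≤ n → 1 ≤ ⌊√ n ⌋
⌊√⌋-pos {n} 1≤n = ≰⇒> λ σ≤0 →
  <⇒≱ (⌊√⌋-upper n) (≤-trans (*-mono-≤ (s≤s σ≤0) (s≤s σ≤0)) 1≤n)

power-of-two-above : ∀ m → 1 ≤ m → ∃ λ K → m ≤ 2 ^ K × 2 ^ K ≤ 2 * m
power-of-two-above (suc zero)    _ = 0 , s≤s z≤n , s≤s z≤n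
power-of-two-above (suc (suc m)) _ with power-of-two-above (suc m) (s≤s z≤n)
... | K , lo , hi with suc (suc m) ≤? 2 ^ K
...   | yes p = K , p , ≤-trans hi (*-monoʳ-≤ 2 (n≤1+n (suc m)))
...   | no ¬p = suc K ,
          ≤-trans (+-mono-≤ (s≤s (z≤n {m})) (≤-reflexive (sym (+-identityʳ (suc m))))) (*-monoʳ-≤ 2 lo) ,
          *-monoʳ-≤ 2 (<⇒≤ (≰⇒> ¬p))

half-≤ : ∀ c n w S k → n * suc k ≤ (w * suc k + c * S) * 2 →
  ℤ.+ n ℚ./ 2 ℚ.≤ ℤ.+ w ℚ./ 1 ℚ.+ (ℤ.+ c ℚ./ 1) ℚ.* (ℤ.+ S ℚ./ suc k)
half-≤ c n w S k h = ℚ.toℚᵘ-cancel-≤ (begin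
  toℚᵘ (ℤ.+ n ℚ./ 2)                             ≃⟨ ℚ.toℚᵘ-fromℚᵘ (mkℚᵘ (ℤ.+ n) 1) ⟩
  mkℚᵘ (ℤ.+ n) 1                                 ≤⟨ ℚᵘ.*≤* cross ⟩
  mkℚᵘ (ℤ.+ w) 0 ℚᵘ.+ mkℚᵘ (ℤ.+ c) 0 ℚᵘ.* mkℚᵘ (ℤ.+ S) k
    ≃⟨ ℚᵘ.+-cong (ℚ.toℚᵘ-fromℚᵘ (mkℚᵘ (ℤ.+ w) 0))
         (ℚᵘ.*-cong (ℚ.toℚᵘ-fromℚᵘ (mkℚᵘ (ℤ.+ c) 0)) (ℚ.toℚᵘ-fromℚᵘ (mkℚᵘ (ℤ.+ S) k))) ⟨
  toℚᵘ (ℤ.+ w ℚ./ 1) ℚᵘ.+ toℚᵘ (ℤ.+ c ℚ./ 1) ℚᵘ.* toℚᵘ (ℤ.+ S ℚ./ suc k)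
    ≃⟨ ℚᵘ.+-congʳ (toℚᵘ (ℤ.+ w ℚ./ 1)) (ℚ.toℚᵘ-homo-* (ℤ.+ c ℚ./ 1) (ℤ.+ S ℚ./ suc k)) ⟨
  toℚᵘ (ℤ.+ w ℚ./ 1) ℚᵘ.+ toℚᵘ ((ℤ.+ c ℚ./ 1) ℚ.* (ℤ.+ S ℚ./ suc k))
    ≃⟨ ℚ.toℚᵘ-homo-+ (ℤ.+ w ℚ./ 1) ((ℤ.+ c ℚ./ 1) ℚ.* (ℤ.+ S ℚ./ suc k)) ⟨
  toℚᵘ (ℤ.+ w ℚ./ 1 ℚ.+ (ℤ.+ c ℚ./ 1) ℚ.* (ℤ.+ S ℚ./ suc k)) ∎)
  where
  open ℚᵘ.≤-Reasoning
  cross : ℤ.+ n ℤ.* ℤ.+ (1 * (1 * suc k)) ℤ.≤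
    (ℤ.+ w ℤ.* ℤ.+ (1 * suc k) ℤ.+ ℤ.+ c ℤ.* ℤ.+ S ℤ.* ℤ.+ 1) ℤ.* ℤ.+ 2
  cross = subst₂ ℤ._≤_
    (trans (cong (λ t → ℤ.+ (n * t)) (sym (trans (*-identityˡ (1 * suc k)) (*-identityˡ (suc k)))))
           (ℤ.pos-* n (1 * (1 * suc k))))
    (trans (ℤ.pos-* (w * suc k + c * S) 2) (cong (ℤ._* ℤ.+ 2)
      (trans (ℤ.pos-+ (w * suc k) (c * S)) (cong₂ ℤ._+_
        (trans (cong (λ t → ℤ.+ (w * t)) (sym (*-identityˡ (suc k)))) (ℤ.pos-* w (1 * suc k)))
        (trans (ℤ.pos-* c S) (sym (ℤ.*-identityʳ (ℤ.+ c ℤ.* ℤ.+ S))))))))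
    (ℤ.+≤+ h)

p≤r+q⇒p-q≤r : ∀ {p} q {r} → p ℚ.≤ r ℚ.+ q → p ℚ.- q ℚ.≤ r
p≤r+q⇒p-q≤r {p} q {r} h = subst (p ℚ.- q ℚ.≤_) (cancel r q) (ℚ.+-monoˡ-≤ (ℚ.- q) h)
  where
  open +-*-Solver
  cancel : ∀ r q → (r ℚ.+ q) ℚ.- q ≡ r
  cancel = solve 2 (λ r q → (r :+ q) :- q := r) refl

-- Every term of the sequence of √ n is at least ⌊√ n ⌋, so w bounds n/2 - c√n from above term by
-- term, and the given ε and N carry over.
outside-ball : ∀ c {n} r → r <ℝ fromℚ (ℤ.+ n ℚ./ 2) -ℝ fromℕ c *ℝ (√ n) →
  ∀ w → n ≤ 2 * (c * ⌊√ n ⌋) + 2 * w → r <ℝ fromℕ w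
outside-ball c {n} r (ε , N , 0<ε , r<) w h = ε , N , 0<ε , λ k N≤k →
  ℚ.≤-trans (r< k N≤k) (p≤r+q⇒p-q≤r ((ℤ.+ c ℚ./ 1) ℚ.* (ℤ.+ ⌊√ n * (suc k * suc k) ⌋ ℚ./ suc k))
    (half-≤ c n w ⌊√ n * (suc k * suc k) ⌋ k (scaled k)))
  where
  open ≤-Reasoning
  scaled : ∀ k → n * suc k ≤ (w * suc k + c * ⌊√ n * (suc k * suc k) ⌋) * 2
  scaled k = begin
    n * suc k                                          ≤⟨ *-monoˡ-≤ (suc k) h ⟩
    (2 * (c * ⌊√ n ⌋) + 2 * w) * suc k                 ≡⟨ lemma c ⌊√ n ⌋ w (suc k) ⟩
    (w * suc k + c * (⌊√ n ⌋ * suc k)) * 2             ≤⟨ *-monoˡ-≤ 2 (+-monoʳ-≤ (w * suc k) (*-monoʳ-≤ c (⌊√⌋-scale n (suc k)))) ⟩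
    (w * suc k + c * ⌊√ n * (suc k * suc k) ⌋) * 2     ∎
    where
    lemma : ∀ c σ w q → (2 * (c * σ) + 2 * w) * q ≡ (w * q + c * (σ * q)) * 2
    lemma = solve-∀

-- 2^K is taken between 4σ and 8σ for σ = ⌊√ n ⌋. Then 4^K ≥ 16σ² ≥ 4(σ + 1)² ≥ 4(n + 1), and
-- 1376·8σ = 2·5504σ is the origin of the constant 5504.
scale-exists : ∀ n → 1 ≤ n → ∃ λ K → 4 * n + 2 ≤ 4 ^ K × 1376 * 2 ^ K ≤ 2 * (5504 * ⌊√ n ⌋)
scale-exists n 1≤n with power-of-two-above (4 * ⌊√ n ⌋) (*-mono-≤ {1} {4} (s≤s z≤n) (⌊√⌋-pos 1≤n))
... | K , lo , hi = K , fits , small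
  where
  open ≤-Reasoning
  σ = ⌊√ n ⌋
  1≤σ = ⌊√⌋-pos 1≤n
  fits : 4 * n + 2 ≤ 4 ^ K
  fits = begin
    4 * n + 2                    ≤⟨ +-monoʳ-≤ (4 * n) (s≤s (s≤s (z≤n {2}))) ⟩
    4 * n + 4                    ≡⟨ lemma₁ n ⟩
    4 * suc n                    ≤⟨ *-monoʳ-≤ 4 (⌊√⌋-upper n) ⟩
    4 * (suc σ * suc σ)          ≤⟨ *-monoʳ-≤ 4 (*-mono-≤ (+-monoˡ-≤ σ 1≤σ) (+-monoˡ-≤ σ 1≤σ)) ⟩
    4 * ((σ + σ) * (σ + σ))      ≡⟨ lemma₂ σ ⟩
    4 * σ * (4 * σ)              ≤⟨ *-mono-≤ lo lo ⟩
    2 ^ K * 2 ^ K                ≡⟨ ^-distribʳ-* 2 2 K ⟨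
    4 ^ K                        ∎
    where
    lemma₁ : ∀ n → 4 * n + 4 ≡ 4 * suc n
    lemma₁ = solve-∀
    lemma₂ : ∀ σ → 4 * ((σ + σ) * (σ + σ)) ≡ 4 * σ * (4 * σ)
    lemma₂ = solve-∀
  small : 1376 * 2 ^ K ≤ 2 * (5504 * σ)
  small = begin
    1376 * 2 ^ K                 ≤⟨ *-monoʳ-≤ 1376 hi ⟩
    1376 * (2 * (4 * σ))         ≡⟨ lemma 1376 2 4 σ ⟩
    2 * (1376 * 4 * σ)           ∎
    where
    lemma : ∀ a b c σ → a * (b * (c * σ)) ≡ b * (a * c * σ)
    lemma = solve-∀

-- Reduction to decidable classes.

ContainsCoset-mono : ∀ {n k} {P Q : Pred (𝔽₂^ n) 0ℓ} → P ⊆ Q →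
  ContainsCosetOfCodimension k P → ContainsCosetOfCodimension k Q
ContainsCoset-mono P⊆Q (S , coset , S⊆P) = S , coset , P⊆Q ∘ S⊆P

⊞-mono : ∀ {n} {A A′ : Pred (𝔽₂^ n) 0ℓ} → A ⊆ A′ → A ⊞ A ⊆ A′ ⊞ A′
⊞-mono A⊆A′ (a , b , p , q , eq) = a , b , A⊆A′ p , A⊆A′ q , eq

chosenA chosenB : ∀ {P Q R : Set} → P ⊎ Q ⊎ R → Bool
chosenA (inj₂ (inj₁ _)) = true
chosenA _               = false
chosenB (inj₂ (inj₂ _)) = true
chosenB _               = false

-- The sets in a cover need not be decidable, but the classes chosen by a covering function are.
module _ {n} {H A B : Pred (𝔽₂^ n) 0ℓ} (cover : ∀ x → (H ∪ A ∪ B) x) where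

  ClassA ClassB : Pred (𝔽₂^ n) 0ℓ
  ClassA x = T (chosenA (cover x))
  ClassB x = T (chosenB (cover x))

  ClassA⊆A : ClassA ⊆ A
  ClassA⊆A {x} p with cover x
  ... | inj₂ (inj₁ a) = a

  ClassB⊆B : ClassB ⊆ B
  ClassB⊆B {x} p with cover x
  ... | inj₂ (inj₂ b) = b

  classes-cover : ∀ x → ¬ H x → ClassA x ⊎ ClassB x
  classes-cover x ¬h with cover x
  ... | inj₁ h        = contradiction h ¬h
  ... | inj₂ (inj₁ _) = inj₁ tt
  ... | inj₂ (inj₂ _) = inj₂ tt

open import Data.Integer.Base using (+_)
open import Data.Rational.Base using (_/_)
open import Relation.Unary using (U)

theorem2 : Σ ℝ λ C → 0ℝ <ℝ C × (Σ ℕ λ n₀ →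
    (n : ℕ) → n₀ ≤ n →
    (r : ℝ) → r <ℝ fromℚ (+ n / 2) -ℝ C *ℝ (√ n) →
    (A B : Pred (𝔽₂^ n) 0ℓ) → U ≐ (HammingBall r ∪ A ∪ B) →
    ContainsCosetOfCodimension 1 (A ⊞ A) ⊎ ContainsCosetOfCodimension 1 (B ⊞ B))
theorem2 = fromℕ 5504 , positive , 1 , λ n 1≤n r r< A B (cover , _) →
  let f = λ x → cover {x} tt
      (K , fits , small) = scale-exists n 1≤n
  in Sum.map (ContainsCoset-mono (⊞-mono (ClassA⊆A f))) (ContainsCoset-mono (⊞-mono (ClassB⊆B f)))
       (two-class-cover K 1≤n fits (T? ∘ chosenA ∘ f) (T? ∘ chosenB ∘ f)
         -- Membership in the ball is by definition the negation of the strict inequality that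
         -- `outside-ball` supplies.
         λ x high → classes-cover f x λ inBall →
           inBall (outside-ball 5504 r r< (weight x) (≤-trans high (+-monoˡ-≤ (2 * weight x) small))))
  where
  positive : 0ℝ <ℝ fromℕ 5504
  positive = 1ℚ , 0 , ℚ.positive⁻¹ 1ℚ , λ _ _ → ℚ.≤ᵇ⇒≤ tt
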